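{- Let $Q(n)$ be the number of $n$-quasigroups of order $4$ on the set $A=\{0,1,2,3\}$. Then there is a constant $c$ (independent of $n$) such that for every natural number $n\ge 1$, $$Q(n) \leq 2^{(n+c)2^{n-1}},$$ and the right-hand side equals $2^{2^{n+\log_2 n - 1 + o(1)}}$ as $n\to\infty$.
   Context: Let $A=\{0,1,2,3\}$. For a natural number $n$, an $n$-quasigroup (of order $4$) is a pair $(A,q)$ where $q:A^n\to A$ satisfies $q(c)\neq q(c')$ for all $c,c'\in A^n$ that differ in exactly one coordinate. $Q(n)$ denotes the number of different $n$-quasigroups $(A,q)$, i.e. the number of such maps $q$ (not up to equivalence). -}

module Defs where

open import Algebra.Bundles using (CommutativeRing)
open import Data.Empty using (⊥)
open import Data.Fin.Base using (Fin; zero; suc)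
import Data.Fin.Properties as Fin
open import Data.Integer.Base as ℤ using (ℤ; +_; -[1+_])
import Data.Integer.Properties as ℤ
import Data.Integer.Solver as ℤ
open import Data.List.Base as List using (List; []; _∷_; length; filter; map; cartesianProductWith; allFin)
import Data.List.Membership.Propositional.Properties as ∈
import Data.List.Membership.Setoid as Membership
import Data.List.Membership.Setoid.Properties as ∈ₛ
open import Data.List.Relation.Unary.All as All using (All; []; _∷_)
import Data.List.Relation.Unary.All.Properties as All
import Data.List.Relation.Unary.AllPairs as AllPairs
import Data.List.Relation.Unary.Any as Any
open import Data.List.Relation.Unary.Any.Properties using (lookup-index)
open import Data.List.Relation.Unary.Enumerates.Setoid using (IsEnumeration)
open import Data.List.Relation.Unary.Unique.Propositional.Properties using (allFin⁺)
open import Data.List.Relation.Unary.Unique.Setoid using (Unique)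
import Data.List.Relation.Unary.Unique.Setoid.Properties as Unique
open import Data.Nat.Base as ℕ using (ℕ; zero; suc)
import Data.Nat.Properties as ℕ
open import Data.Product using (Σ; ∃; ∃!; _×_; _,_; proj₁; proj₂)
open import Data.Rational
open import Data.Rational.Properties hiding (_≟_)
open import Data.Rational.Solver using (module +-*-Solver)
import Data.Rational.Unnormalised as ℚᵘ
import Data.Rational.Unnormalised.Properties as ℚᵘ
open import Data.Sum.Base as Sum using (_⊎_; inj₁; inj₂; [_,_]′)
open import Data.Vec.Base as Vec using (Vec; []; _∷_; lookup)
open import Data.Vec.Relation.Binary.Pointwise.Inductive as Pointwise using (Pointwise; []; _∷_)
open import Function.Bundles using (Inverse; _⇔_)
open import Level using (0ℓ)
open import Relation.Binary.Bundles using (Setoid)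
open import Relation.Binary.PropositionalEquality as ≡
  using (_≡_; _≢_; refl; sym; trans; cong; cong₂; subst; subst₂)
open import Relation.Nullary using (¬_; Dec; yes; no; contradiction)
open import Relation.Nullary.Decidable using (map′; ¬?; _×-dec_; _→-dec_)
open import Relation.Unary using (Pred; Decidable)

open import Algebra.Properties.CommutativeSemiring.Exp
  (CommutativeRing.commutativeSemiring +-*-commutativeRing)
  using (_^_; ^-assocʳ)
open +-*-Solver using (solve; _:+_; _:*_; _:-_; :-_; _:=_; con)

A : Set
A = Fin 4

Operation : ℕ → Set
Operation n = Vec A n → A

DifferInExactlyOne : ∀ {n} → Vec A n → Vec A n → Set
DifferInExactlyOne c c′ = ∃! _≡_ λ i → lookup c i ≢ lookup c′ i

IsQuasigroup : ∀ {n} → Operation n → Set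
IsQuasigroup q = ∀ c c′ → DifferInExactlyOne c c′ → q c ≢ q c′

operations : ℕ → Setoid 0ℓ 0ℓ
operations n = Vec A n ≡.→-setoid A

quasigroups : ℕ → Setoid 0ℓ 0ℓ
quasigroups n = record
  { Carrier       = Σ (Operation n) IsQuasigroup
  ; _≈_           = λ (q , _) (q′ , _) → q ≈ q′
  ; isEquivalence = record { refl = λ {(q , _)} → E.refl {q} ; sym = E.sym ; trans = E.trans }
  }
  where module E = Setoid (operations n) ; open E using (_≈_)

differInExactlyOne? : ∀ {n} (c c′ : Vec A n) → Dec (DifferInExactlyOne c c′)
differInExactlyOne? c c′ = map′
  (λ (i , ≢ , uniq) → i , ≢ , λ {j} → uniq j)
  (λ (i , ≢ , uniq) → i , ≢ , λ j → uniq {j})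
  (Fin.any? λ i → differ? i ×-dec Fin.all? λ j → differ? j →-dec (i Fin.≟ j))
  where
  differ? : ∀ i → Dec (lookup c i ≢ lookup c′ i)
  differ? i = ¬? (lookup c i Fin.≟ lookup c′ i)

vectors : ∀ {X : Set} → List X → ∀ k → List (Vec X k)
vectors xs zero    = [] ∷ []
vectors xs (suc k) = cartesianProductWith _∷_ xs (vectors xs k)

module _ (S : Setoid 0ℓ 0ℓ) where
  open Setoid S using (_≈_)

  vectors-complete : ∀ {xs} → IsEnumeration S xs → ∀ k →
                     IsEnumeration (Pointwise.setoid S k) (vectors xs k)
  vectors-complete e zero    []      = Any.here []
  vectors-complete e (suc k) (x ∷ v) =
    ∈ₛ.∈-cartesianProductWith⁺ S (Pointwise.setoid S k) (Pointwise.setoid S (suc k)) _∷_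
      (e x) (vectors-complete e k v)

  vectors-unique : ∀ {xs} → Unique S xs → ∀ k → Unique (Pointwise.setoid S k) (vectors xs k)
  vectors-unique u zero    = [] AllPairs.∷ AllPairs.[]
  vectors-unique u (suc k) =
    Unique.cartesianProductWith⁺ S (Pointwise.setoid S k) (Pointwise.setoid S (suc k)) _∷_
      (λ { (p ∷ ps) → p , ps }) u (vectors-unique u k)

tuples : ∀ n → List (Vec A n)
tuples = vectors (allFin 4)

∀tuple? : ∀ {n} {P : Pred (Vec A n) 0ℓ} → Decidable P → Dec (∀ c → P c)
∀tuple? {n} {P} P? = map′ from (λ p → All.universal p (tuples n)) (All.all? P? (tuples n))
  where
  from : All P (tuples n) → ∀ c → P c
  from ps c = All.lookupWith (λ p c≈ → subst P (sym (Pointwise.Pointwise-≡⇒≡ c≈)) p) ps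
    (vectors-complete (≡.setoid A) ∈.∈-allFin n c)

isQuasigroup? : ∀ {n} (q : Operation n) → Dec (IsQuasigroup q)
isQuasigroup? q = ∀tuple? λ c → ∀tuple? λ c′ →
  differInExactlyOne? c c′ →-dec ¬? (q c Fin.≟ q c′)

fromSlices : ∀ {n} → Vec (Operation n) 4 → Operation (suc n)
fromSlices qs (a ∷ c) = lookup qs a c

allOperations : ∀ n → List (Operation n)
allOperations zero    = map (λ a _ → a) (allFin 4)
allOperations (suc n) = map fromSlices (vectors (allOperations n) 4)

-- The number of n-quasigroups, obtained by enumerating all maps Vec A n → A.  Maps are counted
-- up to pointwise equality (function extensionality is not available); Q-counts states that this
-- is the cardinality.
Q : ℕ → ℕ
Q n = length (filter isQuasigroup? (allOperations n))

allOperations-complete : ∀ n → IsEnumeration (operations n) (allOperations n)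
allOperations-complete zero    q = ∈ₛ.∈-resp-≈ (operations 0) (λ { [] → refl })
  (∈ₛ.∈-map⁺ (≡.setoid A) (operations 0) (λ a≡b _ → a≡b) (∈.∈-allFin (q [])))
allOperations-complete (suc n) q = ∈ₛ.∈-resp-≈ (operations (suc n)) {x = fromSlices slices} eq
  (∈ₛ.∈-map⁺ (Pointwise.setoid (operations n) 4) (operations (suc n))
    (λ { ps (a ∷ c) → Pointwise.lookup ps a c })
    (vectors-complete (operations n) (allOperations-complete n) 4 slices))
  where
  slices = Vec.tabulate λ a c → q (a ∷ c)
  eq : ∀ c → fromSlices slices c ≡ q c
  eq (zero ∷ c) = refl
  eq (suc zero ∷ c) = refl
  eq (suc (suc zero) ∷ c) = refl
  eq (suc (suc (suc zero)) ∷ c) = refl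

allOperations-unique : ∀ n → Unique (operations n) (allOperations n)
allOperations-unique zero    = Unique.map⁺ (≡.setoid A) (operations 0) {f = λ a _ → a} (λ eq → eq []) (allFin⁺ 4)
allOperations-unique (suc n) = Unique.map⁺ (Pointwise.setoid (operations n) 4) (operations (suc n))
  (λ {qs} {rs} eq → pointwise qs rs λ a c → eq (a ∷ c)) (vectors-unique (operations n) (allOperations-unique n) 4)
  where
  pointwise : ∀ {k} (qs rs : Vec (Operation n) k) → (∀ i c → lookup qs i c ≡ lookup rs i c) →
              Pointwise (λ q r → ∀ c → q c ≡ r c) qs rs
  pointwise []       []       eq = []
  pointwise (q ∷ qs) (r ∷ rs) eq = eq zero ∷ pointwise qs rs (λ i → eq (suc i))

Q-counts : ∀ n → Inverse (≡.setoid (Fin (Q n))) (quasigroups n)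
Q-counts n = record
  { to        = to
  ; from      = from
  ; to-cong   = λ { refl _ → refl }
  ; from-cong = λ {x} {y} x≈y → injective (from x) (from y)
                  (λ c → trans (sym (right x c)) (trans (x≈y c) (right y c)))
  ; inverse   = (λ { {x} refl c → sym (right x c) })
              , (λ {i} {y} y≈ → injective (from y) i (λ c → trans (sym (right y c)) (y≈ c)))
  }
  where
  qs = filter isQuasigroup? (allOperations n)
  resp : ∀ {q r : Operation n} → (∀ c → q c ≡ r c) → IsQuasigroup q → IsQuasigroup r
  resp eq h c c′ d rc≡rc′ = h c c′ d (trans (eq c) (trans rc≡rc′ (sym (eq c′))))
  to : Fin (Q n) → Σ (Operation n) IsQuasigroup
  to i = List.lookup qs i , All.lookup (All.all-filter isQuasigroup? (allOperations n)) (∈.∈-lookup i)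
  member : (x : Σ (Operation n) IsQuasigroup) → Membership._∈_ (operations n) (proj₁ x) qs
  member (q , h) = ∈ₛ.∈-filter⁺ (operations n) isQuasigroup? resp (allOperations-complete n q) h
  from : Σ (Operation n) IsQuasigroup → Fin (Q n)
  from x = Any.index (member x)
  right : ∀ x c → proj₁ x c ≡ List.lookup qs (from x) c
  right x = lookup-index (member x)
  injective : ∀ i j → (∀ c → List.lookup qs i c ≡ List.lookup qs j c) → i ≡ j
  injective = go (Unique.filter⁺ (operations n) isQuasigroup? (allOperations-unique n))
    where
    go : ∀ {xs : List (Operation n)} → Unique (operations n) xs →
         ∀ i j → (∀ c → List.lookup xs i c ≡ List.lookup xs j c) → i ≡ j
    go (_ AllPairs.∷ _) zero zero eq = refl
    go (x∉ AllPairs.∷ _) zero (suc j) eq = contradiction eq (All.lookup x∉ (∈.∈-lookup j))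
    go (x∉ AllPairs.∷ _) (suc i) zero eq = contradiction (λ c → sym (eq c)) (All.lookup x∉ (∈.∈-lookup i))
    go (_ AllPairs.∷ u) (suc i) (suc j) eq = cong suc (go u i j eq)

2ℚ : ℚ
2ℚ = + 2 / 1

0<1 : 0ℚ < 1ℚ
0<1 = positive⁻¹ 1ℚ

1<2 : 1ℚ < 2ℚ
1<2 = *<* (ℤ.+<+ (ℕ.s≤s (ℕ.s≤s ℕ.z≤n)))

ℕ→ℚ : ℕ → ℚ
ℕ→ℚ n = + n / 1

ℕ→ℚ-suc : ∀ n → ℕ→ℚ (suc n) ≡ 1ℚ + ℕ→ℚ n
ℕ→ℚ-suc n = toℚᵘ-injective (begin
  toℚᵘ (ℕ→ℚ (suc n))           ≈⟨ toℚᵘ-fromℚᵘ (ℚᵘ.mkℚᵘ (+ suc n) 0) ⟩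
  ℚᵘ.mkℚᵘ (+ suc n) 0            ≈⟨ ℚᵘ.*≡* (cong (ℤ._* + 1) (cong (λ z → + 1 ℤ.+ z) (sym (ℤ.*-identityʳ (+ n))))) ⟩
  ℚᵘ.1ℚᵘ ℚᵘ.+ ℚᵘ.mkℚᵘ (+ n) 0    ≈⟨ ℚᵘ.+-congʳ ℚᵘ.1ℚᵘ (ℚᵘ.≃-sym (toℚᵘ-fromℚᵘ (ℚᵘ.mkℚᵘ (+ n) 0))) ⟩
  toℚᵘ 1ℚ ℚᵘ.+ toℚᵘ (ℕ→ℚ n)    ≈⟨ ℚᵘ.≃-sym (toℚᵘ-homo-+ 1ℚ (ℕ→ℚ n)) ⟩
  toℚᵘ (1ℚ + ℕ→ℚ n)            ∎)
  where open ℚᵘ.≃-Reasoning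

<-by : ∀ {x y} d → 0ℚ < d → y ≡ x + d → x < y
<-by {x} d 0<d refl = subst (_< x + d) (+-identityʳ x) (+-monoʳ-< x 0<d)

≤-by : ∀ {x y} d → 0ℚ ≤ d → y ≡ x + d → x ≤ y
≤-by {x} d 0≤d refl = subst (_≤ x + d) (+-identityʳ x) (+-monoʳ-≤ x 0≤d)

x<y⇒0<y-x : ∀ {x y} → x < y → 0ℚ < y - x
x<y⇒0<y-x {x} {y} x<y = subst (_< y - x) (+-inverseʳ x) (+-monoˡ-< (- x) x<y)

+-pos : ∀ {x y} → 0ℚ < x → 0ℚ ≤ y → 0ℚ < x + y
+-pos = +-mono-<-≤

*-pos : ∀ {x y} → 0ℚ < x → 0ℚ < y → 0ℚ < x * y
*-pos {x} {y} 0<x 0<y =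
  subst (_< x * y) (*-zeroʳ x) (*-monoʳ-<-pos x ⦃ positive 0<x ⦄ 0<y)

*-nonNeg : ∀ {x y} → 0ℚ ≤ x → 0ℚ ≤ y → 0ℚ ≤ x * y
*-nonNeg {x} {y} 0≤x 0≤y =
  subst (_≤ x * y) (*-zeroʳ x) (*-monoˡ-≤-nonNeg x ⦃ nonNegative 0≤x ⦄ 0≤y)

*ʳ-mono-< : ∀ {x y z} → 0ℚ < z → x < y → x * z < y * z
*ʳ-mono-< {z = z} 0<z = *-monoˡ-<-pos z ⦃ positive 0<z ⦄

*ʳ-mono-≤ : ∀ {x y z} → 0ℚ ≤ z → x ≤ y → x * z ≤ y * z
*ʳ-mono-≤ {z = z} 0≤z = *-monoʳ-≤-nonNeg z ⦃ nonNegative 0≤z ⦄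

*ˡ-mono-< : ∀ {x y z} → 0ℚ < z → x < y → z * x < z * y
*ˡ-mono-< {z = z} 0<z = *-monoʳ-<-pos z ⦃ positive 0<z ⦄

*ˡ-mono-≤ : ∀ {x y z} → 0ℚ ≤ z → x ≤ y → z * x ≤ z * y
*ˡ-mono-≤ {z = z} 0≤z = *-monoˡ-≤-nonNeg z ⦃ nonNegative 0≤z ⦄

*-mono-≤ : ∀ {a b c d} → 0ℚ ≤ a → 0ℚ ≤ d → a ≤ b → c ≤ d → a * c ≤ b * d
*-mono-≤ 0≤a 0≤d a≤b c≤d = ≤-trans (*ˡ-mono-≤ 0≤a c≤d) (*ʳ-mono-≤ 0≤d a≤b)

*ʳ-cancel-< : ∀ {x y z} → 0ℚ ≤ z → x * z < y * z → x < y
*ʳ-cancel-< {z = z} 0≤z = *-cancelʳ-<-nonNeg z ⦃ nonNegative 0≤z ⦄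

*ˡ-cancel-< : ∀ {x y z} → 0ℚ ≤ z → z * x < z * y → x < y
*ˡ-cancel-< {z = z} 0≤z = *-cancelˡ-<-nonNeg z ⦃ nonNegative 0≤z ⦄

inverse : ∀ {x} → 0ℚ < x → ∃ λ y → 0ℚ < y × x * y ≡ 1ℚ
inverse {x} 0<x = 1/ x , positive⁻¹ (1/ x) ⦃ 1/pos⇒pos x ⦄ , *-inverseʳ x
  where instance
    x-pos : Positive x
    x-pos = positive 0<x
    x-nz : NonZero x
    x-nz = pos⇒nonZero x

≤∣numerator∣ : ∀ x → x ≤ ℕ→ℚ ℤ.∣ ↥ x ∣
≤∣numerator∣ x@record{} = toℚᵘ-cancel-≤
  (ℚᵘ.≤-trans (ℚᵘ.*≤* le) (ℚᵘ.≤-reflexive (ℚᵘ.≃-sym (toℚᵘ-fromℚᵘ (ℚᵘ.mkℚᵘ (+ ℤ.∣ ↥ x ∣) 0)))))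
  where
  i≤+∣i∣ : ∀ i → i ℤ.≤ + ℤ.∣ i ∣
  i≤+∣i∣ (+ n)    = ℤ.≤-refl
  i≤+∣i∣ -[1+ n ] = ℤ.-≤+
  le : ↥ x ℤ.* + 1 ℤ.≤ + ℤ.∣ ↥ x ∣ ℤ.* ↧ x
  le = ℤ.≤-trans (ℤ.≤-reflexive (ℤ.*-identityʳ (↥ x)))
      (ℤ.≤-trans (i≤+∣i∣ (↥ x))
      (subst (+ ℤ.∣ ↥ x ∣ ℤ.≤_) (ℤ.pos-* ℤ.∣ ↥ x ∣ (↧ₙ x))
        (ℤ.+≤+ (ℕ.m≤m*n ℤ.∣ ↥ x ∣ (↧ₙ x)))))

0≤ℕ→ℚ : ∀ n → 0ℚ ≤ ℕ→ℚ n
0≤ℕ→ℚ zero    = ≤-refl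
0≤ℕ→ℚ (suc n) = subst (0ℚ ≤_) (sym (ℕ→ℚ-suc n)) (<⇒≤ (+-pos 0<1 (0≤ℕ→ℚ n)))

archimedean : ∀ x {t} → 0ℚ < t → ∃ λ n → x < ℕ→ℚ (suc n) * t
archimedean x {t} 0<t = n , (begin-strict
  x                 ≡⟨ *-identityʳ x ⟨
  x * 1ℚ            ≡⟨ cong (x *_) ty≡1 ⟨
  x * (t * y)       ≡⟨ solve 3 (λ x t y → x :* (t :* y) := x :* y :* t) refl x t y ⟩
  x * y * t         ≤⟨ *ʳ-mono-≤ (<⇒≤ 0<t) (≤∣numerator∣ (x * y)) ⟩
  ℕ→ℚ n * t       <⟨ *ʳ-mono-< {ℕ→ℚ n} {ℕ→ℚ (suc n)} 0<t (<-by 1ℚ 0<1 (trans (ℕ→ℚ-suc n) (+-comm 1ℚ (ℕ→ℚ n)))) ⟩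
  ℕ→ℚ (suc n) * t ∎)
  where
  open ≤-Reasoning
  y = proj₁ (inverse 0<t)
  ty≡1 = proj₂ (proj₂ (inverse 0<t))
  n = ℤ.∣ ↥ (x * y) ∣

^-pos : ∀ {x} → 0ℚ < x → ∀ n → 0ℚ < x ^ n
^-pos 0<x zero    = 0<1
^-pos 0<x (suc n) = *-pos 0<x (^-pos 0<x n)

^-nonNeg : ∀ {x} → 0ℚ ≤ x → ∀ n → 0ℚ ≤ x ^ n
^-nonNeg 0≤x zero    = <⇒≤ 0<1
^-nonNeg 0≤x (suc n) = *-nonNeg 0≤x (^-nonNeg 0≤x n)

^-mono-≤ : ∀ {x y} → 0ℚ ≤ x → x ≤ y → ∀ n → x ^ n ≤ y ^ n
^-mono-≤ 0≤x x≤y zero    = ≤-refl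
^-mono-≤ 0≤x x≤y (suc n) =
  *-mono-≤ 0≤x (^-nonNeg (≤-trans 0≤x x≤y) n) x≤y (^-mono-≤ 0≤x x≤y n)

^-mono-< : ∀ {x y} → 0ℚ ≤ x → x < y → ∀ n .⦃ _ : ℕ.NonZero n ⦄ → x ^ n < y ^ n
^-mono-< 0≤x x<y (suc n) =
  ≤-<-trans (*ˡ-mono-≤ 0≤x (^-mono-≤ 0≤x (<⇒≤ x<y) n))
            (*ʳ-mono-< (^-pos (≤-<-trans 0≤x x<y) n) x<y)

^-cancel-< : ∀ {x y} → 0ℚ ≤ y → ∀ n → x ^ n < y ^ n → x < y
^-cancel-< {x} {y} 0≤y n xⁿ<yⁿ with x <? y
... | yes x<y = x<y
... | no  x≮y = contradiction xⁿ<yⁿ (≤⇒≯ (^-mono-≤ 0≤y (≮⇒≥ x≮y) n))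
  where
  ≤⇒≯ : ∀ {p q} → p ≤ q → ¬ (q < p)
  ≤⇒≯ p≤q q<p = <-irrefl refl (≤-<-trans p≤q q<p)

0^n : ∀ n .⦃ _ : ℕ.NonZero n ⦄ → 0ℚ ^ n ≡ 0ℚ
0^n (suc n) = *-zeroˡ (0ℚ ^ n)

^-comm : ∀ x m n → (x ^ m) ^ n ≡ (x ^ n) ^ m
^-comm x m n = trans (^-assocʳ x m n) (trans (cong (x ^_) (ℕ.*-comm m n)) (sym (^-assocʳ x n m)))

bernoulli : ∀ {x e} → 0ℚ < x → 0ℚ < e → ∀ n →
            x ^ n * (x + ℕ→ℚ n * e) ≤ x * (x + e) ^ n
bernoulli {x} {e} 0<x 0<e zero    = ≤-reflexive
  (solve 2 (λ x e → con 1ℚ :* (x :+ con 0ℚ :* e) := x :* con 1ℚ) refl x e)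
bernoulli {x} {e} 0<x 0<e (suc n) = begin
  x ^ suc n * (x + ℕ→ℚ (suc n) * e)
    ≤⟨ ≤-by (x ^ n * (ℕ→ℚ n * (e * e))) (*-nonNeg (^-nonNeg 0≤x n) (*-nonNeg (0≤ℕ→ℚ n) (*-nonNeg 0≤e 0≤e))) eq ⟩
  (x + e) * (x ^ n * (x + ℕ→ℚ n * e))
    ≤⟨ *ˡ-mono-≤ (<⇒≤ (+-pos 0<x 0≤e)) (bernoulli 0<x 0<e n) ⟩
  (x + e) * (x * (x + e) ^ n)
    ≡⟨ solve 3 (λ a x b → a :* (x :* b) := x :* (a :* b)) refl (x + e) x ((x + e) ^ n) ⟩
  x * (x + e) ^ suc n ∎
  where
  open ≤-Reasoning
  0≤x = <⇒≤ 0<x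
  0≤e = <⇒≤ 0<e
  eq : (x + e) * (x ^ n * (x + ℕ→ℚ n * e)) ≡ x ^ suc n * (x + ℕ→ℚ (suc n) * e) + x ^ n * (ℕ→ℚ n * (e * e))
  eq = trans (solve 4 (λ x e p m →
         (x :+ e) :* (p :* (x :+ m :* e)) :=
         x :* p :* (x :+ (con 1ℚ :+ m) :* e) :+ p :* (m :* (e :* e))) refl x e (x ^ n) (ℕ→ℚ n))
       (cong (λ m → x ^ suc n * (x + m * e) + x ^ n * (ℕ→ℚ n * (e * e))) (sym (ℕ→ℚ-suc n)))

dbl : ∀ x p → x * (2ℚ * p) ≡ p * (x + x)
dbl = solve 2 (λ x p → x :* (con 2ℚ :* p) := p :* (x :+ x)) refl

x+[y-x] : ∀ x y → x + (y - x) ≡ y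
x+[y-x] = solve 2 (λ x y → x :+ (y :- x) := y) refl

gap-step : ∀ {x p q m} → 0ℚ < x → 0ℚ < p → x < m → p * (x + m) ≤ x * q → 2ℚ * p < q
gap-step {x} {p} {q} {m} 0<x 0<p x<m le = *ˡ-cancel-< {2ℚ * p} {q} {x} (<⇒≤ 0<x) (begin-strict
  x * (2ℚ * p)   ≡⟨ dbl x p ⟩
  p * (x + x)    <⟨ *ˡ-mono-< {x + x} {x + m} {p} 0<p (+-monoʳ-< x x<m) ⟩
  p * (x + m)    ≤⟨ le ⟩
  x * q          ∎)
  where open ≤-Reasoning

^-gap : ∀ {x y} → 0ℚ < x → x < y → ∃ λ k → 2ℚ * x ^ suc k < y ^ suc k
^-gap {x} {y} 0<x x<y = let k , x<ke = archimedean x (x<y⇒0<y-x x<y) in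
    k , gap-step {x} {x ^ suc k} {y ^ suc k} 0<x (^-pos 0<x (suc k)) x<ke
    (subst (λ z → x ^ suc k * (x + ℕ→ℚ (suc k) * (y - x)) ≤ x * z ^ suc k) (x+[y-x] x y)
       (bernoulli {x} {y - x} 0<x (x<y⇒0<y-x x<y) (suc k)))

*-open : ∀ {x y p} → 0ℚ ≤ x → x * y < p → ∃ λ z → y < z × x * z < p
*-open {x} {y} {p} 0≤x xy<p =
  let i , 0<i , i-inv = inverse (+-pos 0<1 0≤x)
      0<di = *-pos {p - x * y} {i} (x<y⇒0<y-x xy<p) 0<i
  in y + (p - x * y) * i , <-by ((p - x * y) * i) 0<di refl , <-by ((p - x * y) * i) 0<di (eq i i-inv)
  where
  lem₁ = solve 3 (λ p x y → p := x :* y :+ (p :- x :* y) :* con 1ℚ) refl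
  lem₂ = solve 4 (λ x y d i → x :* y :+ d :* ((con 1ℚ :+ x) :* i) := x :* (y :+ d :* i) :+ d :* i) refl
  eq : ∀ i → (1ℚ + x) * i ≡ 1ℚ → p ≡ x * (y + (p - x * y) * i) + (p - x * y) * i
  eq i i-inv = trans (lem₁ p x y) (trans (cong (λ u → x * y + (p - x * y) * u) (sym i-inv)) (lem₂ x y (p - x * y) i))

^-open-above : ∀ {x p} → 0ℚ ≤ x → ∀ n → x ^ n < p → ∃ λ z → x < z × z ^ n < p
^-open-above {x} 0≤x zero    1<p = x + 1ℚ , <-by 1ℚ 0<1 refl , 1<p
^-open-above {x} {p} 0≤x (suc n) h =
  let m , xⁿ<m , xm<p = *-open {x} {x ^ n} {p} 0≤x h
      z , x<z , zⁿ<m  = ^-open-above {x} {m} 0≤x n xⁿ<m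
      0<m             = ≤-<-trans (^-nonNeg 0≤x n) xⁿ<m
      w , x<w , mw<p  = *-open {m} {x} {p} (<⇒≤ 0<m) (subst (_< p) (*-comm x m) xm<p)
  in pick m z w 0<m x<z x<w zⁿ<m (subst (_< p) (*-comm m w) mw<p) (≤-total z w)
  where
  pick : ∀ m z w → 0ℚ < m → x < z → x < w → z ^ n < m → w * m < p → z ≤ w ⊎ w ≤ z →
         ∃ λ z → x < z × z ^ suc n < p
  pick m z w 0<m x<z x<w zⁿ<m wm<p (inj₁ z≤w) = z , x<z ,
    ≤-<-trans (*-mono-≤ {z} {w} {z ^ n} {m} (<⇒≤ (≤-<-trans 0≤x x<z)) (<⇒≤ 0<m) z≤w (<⇒≤ zⁿ<m)) wm<p
  pick m z w 0<m x<z x<w zⁿ<m wm<p (inj₂ w≤z) = w , x<w ,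
    ≤-<-trans (*-mono-≤ {w} {w} {w ^ n} {m} 0≤w (<⇒≤ 0<m) ≤-refl (≤-trans (^-mono-≤ 0≤w w≤z n) (<⇒≤ zⁿ<m))) wm<p
    where 0≤w = <⇒≤ (≤-<-trans 0≤x x<w)

^-inverse : ∀ {x y} → x * y ≡ 1ℚ → ∀ n → x ^ n * y ^ n ≡ 1ℚ
^-inverse xy≡1 zero    = refl
^-inverse {x} {y} xy≡1 (suc n) =
  trans (shuffle x y (x ^ n) (y ^ n)) (cong₂ _*_ xy≡1 (^-inverse {x} {y} xy≡1 n))
  where shuffle = solve 4 (λ x y p q → x :* p :* (y :* q) := x :* y :* (p :* q)) refl

reciprocal-< : ∀ {x y x′ y′} → 0ℚ < x → 0ℚ < y′ → x * x′ ≡ 1ℚ → y * y′ ≡ 1ℚ → x < y → y′ < x′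
reciprocal-< {x} {y} {x′} {y′} 0<x 0<y′ xx′ yy′ x<y = *ˡ-cancel-< {y′} {x′} {x} (<⇒≤ 0<x)
  (subst (x * y′ <_) (trans yy′ (sym xx′)) (*ʳ-mono-< {x} {y} {y′} 0<y′ x<y))

^-open-below : ∀ {x p} → 0ℚ < x → 0ℚ < p → ∀ n → p < x ^ n → ∃ λ z → 0ℚ < z × z < x × p < z ^ n
^-open-below {x} {p} 0<x 0<p n p<xⁿ =
  let y , 0<y , xy≡1 = inverse 0<x
      q , 0<q , pq≡1 = inverse 0<p
      yⁿ<q           = reciprocal-< {p} {x ^ n} {q} {y ^ n} 0<p (^-pos 0<y n) pq≡1 (^-inverse {x} {y} xy≡1 n) p<xⁿ
      w , y<w , wⁿ<q = ^-open-above {y} {q} (<⇒≤ 0<y) n yⁿ<q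
      0<w            = <-trans 0<y y<w
      z , 0<z , wz≡1 = inverse 0<w
  in z , 0<z
   , reciprocal-< {y} {w} {x} {z} 0<y 0<z (trans (*-comm y x) xy≡1) wz≡1 y<w
   , reciprocal-< {w ^ n} {q} {z ^ n} {p} (^-pos 0<w n) 0<p (^-inverse {w} {z} wz≡1 n) (trans (*-comm q p) pq≡1) wⁿ<q

pow2 : ℤ → ℚ
pow2 (+ n)    = 2ℚ ^ n
pow2 -[1+ n ] = ½ ^ suc n

0<pow2 : ∀ i → 0ℚ < pow2 i
0<pow2 (+ n)    = ^-pos (positive⁻¹ 2ℚ) n
0<pow2 -[1+ n ] = ^-pos (positive⁻¹ ½) (suc n)

pow2-suc : ∀ i → pow2 (ℤ.suc i) ≡ 2ℚ * pow2 i
pow2-suc (+ n)          = refl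
pow2-suc -[1+ zero ]    = refl
pow2-suc -[1+ suc n ]   = double-half (½ ^ suc n)
  where double-half = solve 1 (λ p → p := con 2ℚ :* (con ½ :* p)) refl

pow2-suc-< : ∀ i → pow2 i < pow2 (ℤ.suc i)
pow2-suc-< i = subst₂ _<_ (*-identityˡ (pow2 i)) (sym (pow2-suc i)) (*ʳ-mono-< {1ℚ} {2ℚ} {pow2 i} (0<pow2 i) 1<2)

i+[1+k] : ∀ i k → i ℤ.+ (+ 1 ℤ.+ k) ≡ + 1 ℤ.+ i ℤ.+ k
i+[1+k] i k = trans (sym (ℤ.+-assoc i (+ 1) k)) (cong (λ j → j ℤ.+ k) (ℤ.+-comm i (+ 1)))

pow2-≤ : ∀ i k → pow2 i ≤ pow2 (i ℤ.+ + k)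
pow2-≤ i zero    = ≤-reflexive (cong pow2 (sym (ℤ.+-identityʳ i)))
pow2-≤ i (suc k) = ≤-trans (<⇒≤ (pow2-suc-< i))
  (subst (λ j → pow2 (ℤ.suc i) ≤ pow2 j) (sym (i+[1+k] i (+ k))) (pow2-≤ (ℤ.suc i) k))

pow2-mono-≤ : ∀ {i j} → i ℤ.≤ j → pow2 i ≤ pow2 j
pow2-mono-≤ {i} {j} i≤j = subst (λ z → pow2 i ≤ pow2 z) eq (pow2-≤ i ℤ.∣ j ℤ.- i ∣)
  where
  eq : i ℤ.+ + ℤ.∣ j ℤ.- i ∣ ≡ j
  eq = trans (cong (λ z → i ℤ.+ z) (ℤ.0≤i⇒+∣i∣≡i (ℤ.i≤j⇒0≤j-i i≤j)))
       (ℤ.+-*-Solver.solve 2 (λ i j → i ℤ.+-*-Solver.:+ (j ℤ.+-*-Solver.:- i) ℤ.+-*-Solver.:= j) refl i j)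

pow2-mono-< : ∀ {i j} → i ℤ.< j → pow2 i < pow2 j
pow2-mono-< {i} i<j = <-≤-trans (pow2-suc-< i) (pow2-mono-≤ (ℤ.i<j⇒suc[i]≤j i<j))

pow2-* : ∀ i n → pow2 (i ℤ.* + n) ≡ pow2 i ^ n
pow2-* (+ m)    n = trans (cong pow2 (sym (ℤ.pos-* m n))) (sym (^-assocʳ 2ℚ m n))
pow2-* -[1+ m ] zero    = cong pow2 (ℤ.*-zeroʳ -[1+ m ])
pow2-* -[1+ m ] (suc n) = sym (^-assocʳ ½ (suc m) (suc n))

ℕ→ℚ<pow2 : ∀ n → ℕ→ℚ n < 2ℚ ^ n
ℕ→ℚ<pow2 zero    = 0<1
ℕ→ℚ<pow2 (suc n) = subst₂ _<_ (sym (ℕ→ℚ-suc n)) (double (2ℚ ^ n)) (+-mono-≤-< (1≤2^ n) (ℕ→ℚ<pow2 n))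
  where
  double = solve 1 (λ p → p :+ p := con 2ℚ :* p) refl
  1≤2^ : ∀ n → 1ℚ ≤ 2ℚ ^ n
  1≤2^ n = pow2-mono-≤ {+ 0} {+ n} (ℤ.+≤+ ℕ.z≤n)

<pow2 : ∀ x → ∃ λ n → x < 2ℚ ^ suc n
<pow2 x = let n , x<n = archimedean x 0<1 in
  n , <-trans (subst (x <_) (*-identityʳ (ℕ→ℚ (suc n))) x<n) (ℕ→ℚ<pow2 (suc n))

pow2< : ∀ {x} → 0ℚ < x → ∃ λ n → ½ ^ suc n < x
pow2< {x} 0<x =
  let y , 0<y , xy≡1 = inverse 0<x
      n , y<2ⁿ       = <pow2 y
  in n , reciprocal-< {y} {2ℚ ^ suc n} {x} {½ ^ suc n} 0<y (0<pow2 -[1+ n ])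
           (trans (*-comm y x) xy≡1) (^-inverse {2ℚ} {½} refl (suc n)) y<2ⁿ

floor-log : ∀ {x} → 0ℚ < x → ∃ λ i → pow2 i ≤ x × x < pow2 (ℤ.suc i)
floor-log {x} 0<x =
  let m , lo = pow2< 0<x
      n , hi = <pow2 x
  in search (suc m ℕ.+ suc n) -[1+ m ] (<⇒≤ lo) (subst (λ j → x < pow2 j) (sym (eq m n)) hi)
  where
  eq : ∀ m n → -[1+ m ] ℤ.+ + (suc m ℕ.+ suc n) ≡ + suc n
  eq m n = trans (ℤ.≤-⊖ (ℕ.m≤m+n (suc m) (suc n))) (cong +_ (ℕ.m+n∸m≡n (suc m) (suc n)))
  search : ∀ n i → pow2 i ≤ x → x < pow2 (i ℤ.+ + n) → ∃ λ i → pow2 i ≤ x × x < pow2 (ℤ.suc i)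
  step   : ∀ n i → pow2 i ≤ x → x < pow2 (i ℤ.+ + suc n) → Dec (x < pow2 (ℤ.suc i)) →
           ∃ λ i → pow2 i ≤ x × x < pow2 (ℤ.suc i)
  search zero    i lo hi =
    contradiction (≤-<-trans lo (subst (λ j → x < pow2 j) (ℤ.+-identityʳ i) hi)) (<-irrefl refl)
  search (suc n) i lo hi = step n i lo hi (x <? pow2 (ℤ.suc i))
  step n i lo hi (yes x<) = i , lo , x<
  step n i lo hi (no  x≮) = search n (ℤ.suc i) (≮⇒≥ x≮) (subst (λ j → x < pow2 j) (i+[1+k] i (+ n)) hi)
infix 4 _<2^_ _>2^_

-- r <2^ q and r >2^ q compare the rational r with the real number 2 ^ q for rational q = a / b:
-- after raising both sides to the power b > 0, r is compared as r ^ b against 2 ^ a.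
-- Negative r is first replaced by 0, since r ^ b loses the sign of r when b is even.
_<2^_ : ℚ → ℚ → Set
r <2^ q = (0ℚ ⊔ r) ^ ↧ₙ q < pow2 (↥ q)

_>2^_ : ℚ → ℚ → Set
r >2^ q = pow2 (↥ q) < (0ℚ ⊔ r) ^ ↧ₙ q

0≤0⊔ : ∀ r → 0ℚ ≤ 0ℚ ⊔ r
0≤0⊔ r = p≤p⊔q 0ℚ r

0⊔-pos : ∀ {r} → 0ℚ < r → 0ℚ ⊔ r ≡ r
0⊔-pos 0<r = p≤q⇒p⊔q≡q (<⇒≤ 0<r)

0⊔-cancel-< : ∀ {r s} → 0ℚ ⊔ r < 0ℚ ⊔ s → r < s
0⊔-cancel-< {r} {s} h = ≰⇒> λ s≤r → <-irrefl refl (<-≤-trans h (⊔-monoʳ-≤ 0ℚ s≤r))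

module _ {R : ℚ} (0≤R : 0ℚ ≤ R) where

  pow2-transport : ∀ {i d j e} → i ℤ.* + e ℤ.≤ j ℤ.* + d → pow2 i ^ e ≤ pow2 j ^ d
  pow2-transport {i} {d} {j} {e} h = subst₂ _≤_ (pow2-* i e) (pow2-* j d) (pow2-mono-≤ h)

  pow2-transport-< : ∀ {i d j e} → i ℤ.* + e ℤ.< j ℤ.* + d → pow2 i ^ e < pow2 j ^ d
  pow2-transport-< {i} {d} {j} {e} h = subst₂ _<_ (pow2-* i e) (pow2-* j d) (pow2-mono-< h)

  >-transport : ∀ i d .⦃ _ : ℕ.NonZero d ⦄ j e →
                i ℤ.* + e ℤ.≤ j ℤ.* + d → pow2 j < R ^ e → pow2 i < R ^ d
  >-transport i d j e h lt = ^-cancel-< (^-nonNeg 0≤R d) e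
    (≤-<-trans (pow2-transport {i} {d} {j} {e} h)
      (subst (pow2 j ^ d <_) (^-comm R e d) (^-mono-< (<⇒≤ (0<pow2 j)) lt d)))

  >-transport-< : ∀ i d j e → i ℤ.* + e ℤ.< j ℤ.* + d → pow2 j ≤ R ^ e → pow2 i < R ^ d
  >-transport-< i d j e h le = ^-cancel-< (^-nonNeg 0≤R d) e
    (<-≤-trans (pow2-transport-< {i} {d} {j} {e} h)
      (subst (pow2 j ^ d ≤_) (^-comm R e d) (^-mono-≤ (<⇒≤ (0<pow2 j)) le d)))

  <-transport : ∀ i d .⦃ _ : ℕ.NonZero d ⦄ j e →
                j ℤ.* + d ℤ.≤ i ℤ.* + e → R ^ e < pow2 j → R ^ d < pow2 i
  <-transport i d j e h lt = ^-cancel-< (<⇒≤ (0<pow2 i)) e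
    (<-≤-trans
      (subst (_< pow2 j ^ d) (^-comm R e d) (^-mono-< (^-nonNeg 0≤R e) lt d))
      (pow2-transport {j} {e} {i} {d} h))

  <-transport-< : ∀ i d j e → j ℤ.* + d ℤ.< i ℤ.* + e → R ^ e ≤ pow2 j → R ^ d < pow2 i
  <-transport-< i d j e h le = ^-cancel-< (<⇒≤ (0<pow2 i)) e
    (≤-<-trans
      (subst (_≤ pow2 j ^ d) (^-comm R e d) (^-mono-≤ (^-nonNeg 0≤R e) le d))
      (pow2-transport-< {j} {e} {i} {d} h))

>2^-lower : ∀ {r q q′} → q ≤ q′ → r >2^ q′ → r >2^ q
>2^-lower {r} {q} {q′} q≤q′ = >-transport (0≤0⊔ r) (↥ q) (↧ₙ q) (↥ q′) (↧ₙ q′) (drop-*≤* q≤q′)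

<2^-upper : ∀ {r q q′} → q ≤ q′ → r <2^ q → r <2^ q′
<2^-upper {r} {q} {q′} q≤q′ = <-transport (0≤0⊔ r) (↥ q′) (↧ₙ q′) (↥ q) (↧ₙ q) (drop-*≤* q≤q′)

>2^-mono : ∀ {r s} q → r ≤ s → r >2^ q → s >2^ q
>2^-mono {r} {s} q r≤s h = <-≤-trans h (^-mono-≤ (0≤0⊔ r) (⊔-monoʳ-≤ 0ℚ r≤s) (↧ₙ q))

<2^-anti : ∀ {r s} q → r ≤ s → s <2^ q → r <2^ q
<2^-anti {r} {s} q r≤s h = ≤-<-trans (^-mono-≤ (0≤0⊔ r) (⊔-monoʳ-≤ 0ℚ r≤s) (↧ₙ q)) h

2^-cancel : ∀ {r q q′} → r >2^ q → r <2^ q′ → q < q′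
2^-cancel {r} {q} {q′} h h′ = ≰⇒> λ q′≤q → <-asym h (<2^-upper {r} {q′} {q} q′≤q h′)

2^-between : ∀ {r s} q → r <2^ q → s >2^ q → r < s
2^-between {r} {s} q h h′ = 0⊔-cancel-< (^-cancel-< (0≤0⊔ s) (↧ₙ q) (<-trans h h′))

2^-cotrans : ∀ r {q q′} → q < q′ → r >2^ q ⊎ r <2^ q′
2^-cotrans r {q} {q′} q<q′ = decide (pow2 (↥ q) <? (0ℚ ⊔ r) ^ ↧ₙ q)
  where
  decide : Dec (r >2^ q) → r >2^ q ⊎ r <2^ q′
  decide (yes h) = inj₁ h
  decide (no ¬h) = inj₂ (<-transport-< (0≤0⊔ r) (↥ q′) (↧ₙ q′) (↥ q) (↧ₙ q) (drop-*<* q<q′) (≮⇒≥ ¬h))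

/-cross : ∀ i d .⦃ _ : ℕ.NonZero d ⦄ → ↥ (i / d) ℤ.* + d ≡ i ℤ.* ↧ (i / d)
/-cross i (suc d) = subst₂ (λ m n → m ℤ.* + suc d ≡ i ℤ.* n)
  (↥ᵘ-toℚᵘ (i / suc d)) (↧ᵘ-toℚᵘ (i / suc d))
  (ℚᵘ.drop-*≡* (toℚᵘ-fromℚᵘ (ℚᵘ.mkℚᵘ i d)))

>2^-/ : ∀ r i d .⦃ _ : ℕ.NonZero d ⦄ → pow2 i < (0ℚ ⊔ r) ^ d → r >2^ (i / d)
>2^-/ r i d = >-transport (0≤0⊔ r) (↥ (i / d)) (↧ₙ (i / d)) i d (ℤ.≤-reflexive (/-cross i d))

<2^-/ : ∀ r i d .⦃ _ : ℕ.NonZero d ⦄ → (0ℚ ⊔ r) ^ d < pow2 i → r <2^ (i / d)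
<2^-/ r i d = <-transport (0≤0⊔ r) (↥ (i / d)) (↧ₙ (i / d)) i d (ℤ.≤-reflexive (sym (/-cross i d)))

</ : ∀ q i d .⦃ _ : ℕ.NonZero d ⦄ → ↥ q ℤ.* + d ℤ.< i ℤ.* ↧ q → q < i / d
</ q@record{} i (suc d) h =
  toℚᵘ-cancel-< (ℚᵘ.<-respʳ-≃ (ℚᵘ.≃-sym (toℚᵘ-fromℚᵘ (ℚᵘ.mkℚᵘ i d))) (ℚᵘ.*<* h))

/< : ∀ q i d .⦃ _ : ℕ.NonZero d ⦄ → i ℤ.* ↧ q ℤ.< ↥ q ℤ.* + d → i / d < q
/< q@record{} i (suc d) h =
  toℚᵘ-cancel-< (ℚᵘ.<-respˡ-≃ (ℚᵘ.≃-sym (toℚᵘ-fromℚᵘ (ℚᵘ.mkℚᵘ i d))) (ℚᵘ.*<* h))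

cross-* : ∀ a b k → a ℤ.* + (b ℕ.* k) ≡ a ℤ.* + k ℤ.* + b
cross-* a b k = trans (cong (λ z → a ℤ.* + z) (ℕ.*-comm b k))
               (trans (cong (λ z → a ℤ.* z) (ℤ.pos-* k b)) (sym (ℤ.*-assoc a (+ k) (+ b))))

>2^-open : ∀ {r} q → r >2^ q → ∃ λ q′ → q < q′ × r >2^ q′
>2^-open {r} q h =
  let k , gap = ^-gap (0<pow2 a) h
  in ℤ.suc (a ℤ.* + suc k) / (b ℕ.* suc k)
   , </ q (ℤ.suc (a ℤ.* + suc k)) (b ℕ.* suc k) (lt (suc k))
   , >2^-/ r (ℤ.suc (a ℤ.* + suc k)) (b ℕ.* suc k)
       (subst₂ _<_ (sym (trans (pow2-suc (a ℤ.* + suc k)) (cong (2ℚ *_) (pow2-* a (suc k)))))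
                   (^-assocʳ (0ℚ ⊔ r) b (suc k)) gap)
  where
  a = ↥ q
  b = ↧ₙ q
  lt : ∀ k → a ℤ.* + (b ℕ.* k) ℤ.< ℤ.suc (a ℤ.* + k) ℤ.* + b
  lt k = subst₂ ℤ._<_ (trans (ℤ.+-identityˡ (a ℤ.* + k ℤ.* + b)) (sym (cross-* a b k)))
                      (sym (ℤ.suc-* (a ℤ.* + k) (+ b)))
                      (ℤ.+-monoˡ-< (a ℤ.* + k ℤ.* + b) (ℤ.+<+ (ℕ.s≤s ℕ.z≤n)))

<2^-open : ∀ {r} q → 0ℚ < r → r <2^ q → ∃ λ q′ → q′ < q × r <2^ q′
<2^-open {r} q 0<r h =
  let k , gap = ^-gap (^-pos (subst (0ℚ <_) (sym (0⊔-pos 0<r)) 0<r) b) h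
      m = a ℤ.* + suc k
  in ℤ.pred m / (b ℕ.* suc k)
   , /< q (ℤ.pred m) (b ℕ.* suc k) (lt (suc k))
   , <2^-/ r (ℤ.pred m) (b ℕ.* suc k)
       (*ˡ-cancel-< {(0ℚ ⊔ r) ^ (b ℕ.* suc k)} {pow2 (ℤ.pred m)} {2ℚ} (<⇒≤ (positive⁻¹ 2ℚ))
         (subst₂ _<_ (cong (2ℚ *_) (^-assocʳ (0ℚ ⊔ r) b (suc k)))
                     (trans (sym (pow2-* a (suc k))) (trans (cong pow2 (sym (ℤ.suc-pred m))) (pow2-suc (ℤ.pred m)))) gap))
  where
  a = ↥ q
  b = ↧ₙ q
  lt : ∀ k → ℤ.pred (a ℤ.* + k) ℤ.* + b ℤ.< a ℤ.* + (b ℕ.* k)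
  lt k = subst₂ ℤ._<_ (sym (ℤ.*-distribʳ-+ (+ b) ℤ.-1ℤ (a ℤ.* + k)))
                      (trans (ℤ.+-identityˡ (a ℤ.* + k ℤ.* + b)) (sym (cross-* a b k)))
                      (ℤ.+-monoˡ-< (a ℤ.* + k ℤ.* + b) ℤ.-<+)

2^-dense : ∀ {r s} → 0ℚ < r → r < s → ∃ λ q → r <2^ q × s >2^ q
2^-dense {r} {s} 0<r r<s =
  let k , gap     = ^-gap 0<r r<s
      i , lo , hi = floor-log (^-pos 0<r (suc k))
  in ℤ.suc i / suc k
   , <2^-/ r (ℤ.suc i) (suc k) (subst (λ z → z ^ suc k < pow2 (ℤ.suc i)) (sym (0⊔-pos 0<r)) hi)
   , >2^-/ s (ℤ.suc i) (suc k) (subst₂ (λ y z → y < z ^ suc k) (sym (pow2-suc i)) (sym (0⊔-pos (<-trans 0<r r<s)))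
       (≤-<-trans (*ˡ-mono-≤ {pow2 i} {r ^ suc k} {2ℚ} (<⇒≤ (positive⁻¹ 2ℚ)) lo) gap))
-- Dedekind reals: L is the set of rationals below the real, U the set of rationals above it.
record ℝ : Set₁ where
  field
    L U         : ℚ → Set
    L-inhabited : ∃ L
    U-inhabited : ∃ U
    L-lower     : ∀ {q r} → q < r → L r → L q
    U-upper     : ∀ {q r} → q < r → U q → U r
    L-open      : ∀ {q} → L q → ∃ λ r → q < r × L r
    U-open      : ∀ {r} → U r → ∃ λ q → q < r × U q
    disjoint    : ∀ {q} → L q → U q → ⊥
    located     : ∀ {q r} → q < r → L q ⊎ U r

open ℝ

infix 4 _≃ℝ_

_≃ℝ_ : ℝ → ℝ → Set
x ≃ℝ y = (∀ q → L x q ⇔ L y q) × (∀ q → U x q ⇔ U y q)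

ℚ→ℝ : ℚ → ℝ
ℚ→ℝ p = record
  { L           = _< p
  ; U           = p <_
  ; L-inhabited = p - 1ℚ , <-by 1ℚ 0<1 (p≡p-1+1 p)
  ; U-inhabited = p + 1ℚ , <-by 1ℚ 0<1 refl
  ; L-lower     = <-trans
  ; U-upper     = λ q<r p<q → <-trans p<q q<r
  ; L-open      = <-dense
  ; U-open      = λ p<r → let q , p<q , q<r = <-dense p<r in q , q<r , p<q
  ; disjoint    = <-asym
  ; located     = λ {q} {r} q<r → Sum.map₂ (λ q≮p → ≤-<-trans (≮⇒≥ q≮p) q<r) (decide (q <? p))
  }
  where
  p≡p-1+1 = solve 1 (λ p → p := p :- con 1ℚ :+ con 1ℚ) refl
  decide : ∀ {A : Set} → Dec A → A ⊎ ¬ A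
  decide (yes a) = inj₁ a
  decide (no ¬a) = inj₂ ¬a

ℕ→ℝ : ℕ → ℝ
ℕ→ℝ n = ℚ→ℝ (ℕ→ℚ n)

L<U : ∀ x {q r} → L x q → U x r → q < r
L<U x {q} {r} Lq Ur = ≰⇒> λ r≤q → [ (λ r<q → disjoint x (L-lower x r<q Lq) Ur)
                                  , (λ r≡q → disjoint x Lq (subst (U x) r≡q Ur)) ]′ (≤⇒<⊎≡ r≤q)
  where
  ≤⇒<⊎≡ : ∀ {p q} → p ≤ q → p < q ⊎ p ≡ q
  ≤⇒<⊎≡ {p} {q} p≤q = decide (p <? q)
    where
    decide : Dec (p < q) → p < q ⊎ p ≡ q
    decide (yes p<q) = inj₁ p<q
    decide (no  p≮q) = inj₂ (≤-antisym p≤q (≮⇒≥ p≮q))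

approximate : ∀ x {δ} → 0ℚ < δ → ∃ λ a → ∃ λ c → L x a × U x c × c - a < δ
approximate x {δ} 0<δ =
  let h , 0<h , h+h<δ = halve
      a , La          = L-inhabited x
      c , Uc          = U-inhabited x
      n , c-a<nh      = archimedean (c - a) 0<h
  in walk h 0<h h+h<δ c Uc (suc n) a La
       (subst₂ _≤_ (x+[y-x] a c) refl (+-monoʳ-≤ a (<⇒≤ c-a<nh)))
  where
  halve : ∃ λ h → 0ℚ < h × h + h < δ
  halve = let d , 0<d , d<δ = <-dense 0<δ in
    ½ * d , *-pos {½} {d} (positive⁻¹ ½) 0<d , subst (_< δ) (½+½ d) d<δ
    where ½+½ = solve 1 (λ d → d := con ½ :* d :+ con ½ :* d) refl
  walk : ∀ h → 0ℚ < h → h + h < δ → ∀ c → U x c → ∀ n a → L x a → c ≤ a + ℕ→ℚ n * h →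
         ∃ λ a → ∃ λ c → L x a × U x c × c - a < δ
  walk h 0<h h+h<δ c Uc zero    a La c≤a =
    contradiction (<-≤-trans (L<U x La Uc) (subst (c ≤_) (a+0h a h) c≤a)) (<-irrefl refl)
    where a+0h = solve 2 (λ a h → a :+ con 0ℚ :* h := a) refl
  walk h 0<h h+h<δ c Uc (suc n) a La c≤ =
    [ (λ L′ → walk h 0<h h+h<δ c Uc n (a + h) L′
        (subst (c ≤_) (trans (cong (λ z → a + z * h) (ℕ→ℚ-suc n)) (step a h (ℕ→ℚ n))) c≤))
    , (λ U′ → a , a + (h + h) , La , U′ , subst (_< δ) (diff a h) h+h<δ)
    ]′ (located x (+-monoʳ-< a (<-by h 0<h refl)))
    where
    step = solve 3 (λ a h n → a :+ (con 1ℚ :+ n) :* h := a :+ h :+ n :* h) refl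
    diff = solve 2 (λ a h → h :+ h := a :+ (h :+ h) :- a) refl

infixl 6 _+ℝ_ _-ℝ_
infix  8 -ℝ_

_+ℝ_ : ℝ → ℝ → ℝ
x +ℝ y = record
  { L           = λ q → ∃ λ a → ∃ λ b → L x a × L y b × q ≡ a + b
  ; U           = λ q → ∃ λ a → ∃ λ b → U x a × U y b × q ≡ a + b
  ; L-inhabited = let a , La = L-inhabited x ; b , Lb = L-inhabited y in a + b , a , b , La , Lb , refl
  ; U-inhabited = let a , Ua = U-inhabited x ; b , Ub = U-inhabited y in a + b , a , b , Ua , Ub , refl
  ; L-lower     = λ {q} q<r (a , b , La , Lb , r≡) →
                    a , q - a , La , L-lower y (subst (q - a <_) (cancel a b) (+-monoˡ-< (- a) (subst (q <_) r≡ q<r))) Lb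
                    , sym (x+[y-x] a q)
  ; U-upper     = λ {q} {r} q<r (a , b , Ua , Ub , q≡) →
                    a , r - a , Ua , U-upper y (subst (_< r - a) (cancel a b) (+-monoˡ-< (- a) (subst (_< r) q≡ q<r))) Ub
                    , sym (x+[y-x] a r)
  ; L-open      = λ {q} (a , b , La , Lb , q≡) →
                    let a′ , a<a′ , La′ = L-open x La in
                    a′ + b , subst (_< a′ + b) (sym q≡) (+-monoˡ-< b a<a′) , a′ , b , La′ , Lb , refl
  ; U-open      = λ {q} (a , b , Ua , Ub , q≡) →
                    let a′ , a′<a , Ua′ = U-open x Ua in
                    a′ + b , subst (a′ + b <_) (sym q≡) (+-monoˡ-< b a′<a) , a′ , b , Ua′ , Ub , refl
  ; disjoint    = λ (a , b , La , Lb , q≡) (c , d , Uc , Ud , q≡′) →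
                    <-irrefl (trans (sym q≡) q≡′) (+-mono-< (L<U x La Uc) (L<U y Lb Ud))
  ; located     = λ {q} {r} q<r →
                    let a , c , La , Uc , c-a<r-q = approximate x (x<y⇒0<y-x q<r) in
                    Sum.map (λ Lb → a , q - a , La , Lb , sym (x+[y-x] a q))
                            (λ Ub → c , r - c , Uc , Ub , sym (x+[y-x] c r))
                            (located y (gap a c q r c-a<r-q))
  }
  where
  cancel = solve 2 (λ a b → a :+ b :- a := b) refl
  lhs = solve 3 (λ a c q → c :- a :+ (q :- c) := q :- a) refl
  rhs = solve 3 (λ c q r → r :- q :+ (q :- c) := r :- c) refl
  gap : ∀ a c q r → c - a < r - q → q - a < r - c
  gap a c q r h = subst₂ _<_ (lhs a c q) (rhs c q r) (+-monoˡ-< (q - c) h)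

neg-involutive : ∀ q → - (- q) ≡ q
neg-involutive = solve 1 (λ q → :- (:- q) := q) refl

-ℝ_ : ℝ → ℝ
-ℝ x = record
  { L           = λ q → U x (- q)
  ; U           = λ q → L x (- q)
  ; L-inhabited = let q , Uq = U-inhabited x in - q , subst (U x) (sym (neg-involutive q)) Uq
  ; U-inhabited = let q , Lq = L-inhabited x in - q , subst (L x) (sym (neg-involutive q)) Lq
  ; L-lower     = λ q<r → U-upper x (neg-antimono-< q<r)
  ; U-upper     = λ q<r → L-lower x (neg-antimono-< q<r)
  ; L-open      = λ {q} Uq → let r , r<-q , Ur = U-open x Uq in
                    - r , subst (_< - r) (neg-involutive q) (neg-antimono-< r<-q)
                        , subst (U x) (sym (neg-involutive r)) Ur
  ; U-open      = λ {q} Lq → let r , -q<r , Lr = L-open x Lq in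
                    - r , subst (- r <_) (neg-involutive q) (neg-antimono-< -q<r)
                        , subst (L x) (sym (neg-involutive r)) Lr
  ; disjoint    = λ Uq Lq → disjoint x Lq Uq
  ; located     = λ q<r → Sum.swap (located x (neg-antimono-< q<r))
  }

_-ℝ_ : ℝ → ℝ → ℝ
x -ℝ y = x +ℝ (-ℝ y)

-- q < log₂ p means 2 ^ q < p, and log₂ p < q means p < 2 ^ q.
log₂ : (p : ℚ) .⦃ _ : Positive p ⦄ → ℝ
log₂ p = record
  { L           = p >2^_
  ; U           = p <2^_
  ; L-inhabited = let n , h = pow2< 0<p in
                  -[1+ n ] / 1 , >2^-/ p -[1+ n ] 1 (subst (½ ^ suc n <_) (sym (trans (*-identityʳ (0ℚ ⊔ p)) (0⊔-pos 0<p))) h)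
  ; U-inhabited = let n , h = <pow2 p in
                  + suc n / 1 , <2^-/ p (+ suc n) 1 (subst (_< 2ℚ ^ suc n) (sym (trans (*-identityʳ (0ℚ ⊔ p)) (0⊔-pos 0<p))) h)
  ; L-lower     = λ {q} {r} q<r → >2^-lower {p} {q} {r} (<⇒≤ q<r)
  ; U-upper     = λ {q} {r} q<r → <2^-upper {p} {q} {r} (<⇒≤ q<r)
  ; L-open      = λ {q} → >2^-open {p} q
  ; U-open      = λ {q} → <2^-open {p} q 0<p
  ; disjoint    = <-asym
  ; located     = λ {q} {r} → 2^-cotrans p {q} {r}
  }
  where
  0<p : 0ℚ < p
  0<p = positive⁻¹ p

log₂ℕ : (n : ℕ) .⦃ _ : ℕ.NonZero n ⦄ → ℝ
log₂ℕ n = log₂ (ℕ→ℚ n) ⦃ normalize-pos n 1 ⦄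

infixr 8 2^_

-- 2 ^ x is the supremum of the 2 ^ q with q < x rational, and the infimum of those with x < q.
2^_ : ℝ → ℝ
2^ x = record
  { L           = λ r → ∃ λ q → L x q × r <2^ q
  ; U           = λ r → ∃ λ q → U x q × r >2^ q
  ; L-inhabited = let q , Lq = L-inhabited x in 0ℚ , q , Lq , 0<2^ q
  ; U-inhabited = let q , Uq = U-inhabited x in 1ℚ + pow2 (↥ q) , q , Uq , big q
  ; L-lower     = λ r<s (q , Lq , s<) → q , Lq , <2^-anti q (<⇒≤ r<s) s<
  ; U-upper     = λ r<s (q , Uq , r>) → q , Uq , >2^-mono q (<⇒≤ r<s) r>
  ; L-open      = λ {r} (q , Lq , r<) →
                    let s , r⁺<s , sⁿ< = ^-open-above (0≤0⊔ r) (↧ₙ q) r<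
                        0<s            = ≤-<-trans (0≤0⊔ r) r⁺<s
                    in s , ≤-<-trans (p≤q⊔p 0ℚ r) r⁺<s
                     , q , Lq , subst (λ z → z ^ ↧ₙ q < pow2 (↥ q)) (sym (0⊔-pos 0<s)) sⁿ<
  ; U-open      = λ {r} (q , Uq , r>) →
                    let 0<r                  = 2^-pos q r>
                        s , 0<s , s<r , <sⁿ  = ^-open-below 0<r (0<pow2 (↥ q)) (↧ₙ q)
                          (subst (λ z → pow2 (↥ q) < z ^ ↧ₙ q) (0⊔-pos 0<r) r>)
                    in s , s<r
                     , q , Uq , subst (λ z → pow2 (↥ q) < z ^ ↧ₙ q) (sym (0⊔-pos 0<s)) <sⁿ
  ; disjoint    = λ {r} (q , Lq , r<) (q′ , Uq′ , r>) → <-asym (L<U x Lq Uq′) (2^-cancel {r} {q′} {q} r> r<)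
  ; located     = λ {r} {s} → locate r s
  }
  where
  0<2^ : ∀ q → 0ℚ <2^ q
  0<2^ q = subst (_< pow2 (↥ q)) (sym (0^n (↧ₙ q))) (0<pow2 (↥ q))

  2^-pos : ∀ {r} q → r >2^ q → 0ℚ < r
  2^-pos q = 2^-between q (0<2^ q)

  big : ∀ q → (1ℚ + pow2 (↥ q)) >2^ q
  big q = subst (λ z → p < z ^ ↧ₙ q) (sym (0⊔-pos (+-pos 0<1 (<⇒≤ 0<p))))
    (<-≤-trans (<-by 1ℚ 0<1 (+-comm 1ℚ p)) (x≤xⁿ (↧ₙ q)))
    where
    p = pow2 (↥ q)
    0<p = 0<pow2 (↥ q)
    1≤1+p : 1ℚ ≤ 1ℚ + p
    1≤1+p = <⇒≤ (<-by p 0<p refl)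
    1≤xⁿ : ∀ n → 1ℚ ≤ (1ℚ + p) ^ n
    1≤xⁿ zero    = ≤-refl
    1≤xⁿ (suc n) = *-mono-≤ {1ℚ} {1ℚ + p} {1ℚ} {(1ℚ + p) ^ n} (<⇒≤ 0<1) (^-nonNeg (≤-trans (<⇒≤ 0<1) 1≤1+p) n) 1≤1+p (1≤xⁿ n)
    x≤xⁿ : ∀ n .⦃ _ : ℕ.NonZero n ⦄ → 1ℚ + p ≤ (1ℚ + p) ^ n
    x≤xⁿ (suc n) = subst (_≤ (1ℚ + p) ^ suc n) (*-identityʳ (1ℚ + p))
      (*ˡ-mono-≤ {1ℚ} {(1ℚ + p) ^ n} {1ℚ + p} (≤-trans (<⇒≤ 0<1) 1≤1+p) (1≤xⁿ n))

  L₂ U₂ : ℚ → Set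
  L₂ r = ∃ λ q → L x q × r <2^ q
  U₂ r = ∃ λ q → U x q × r >2^ q

  locate-pos : ∀ r s → 0ℚ < r → r < s → L₂ r ⊎ U₂ s
  locate-pos r s 0<r r<s =
    let q  , r< , s>  = 2^-dense 0<r r<s
        q′ , q<q′ , s>′ = >2^-open {s} q s>
    in Sum.map (λ Lq → q , Lq , r<) (λ Uq′ → q′ , Uq′ , s>′) (located x q<q′)

  locate : ∀ r s → r < s → L₂ r ⊎ U₂ s
  locate r s r<s = decide (0ℚ <? s)
    where
    decide : Dec (0ℚ < s) → L₂ r ⊎ U₂ s
    decide (yes 0<s) =
      let m , m> , m<s = <-dense (⊔-lub-< 0<s r<s) in
      Sum.map₁ (λ (q , Lq , m<) → q , Lq , <2^-anti {r} {m} q (<⇒≤ (≤-<-trans (p≤q⊔p 0ℚ r) m>)) m<)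
               (locate-pos m s (≤-<-trans (0≤0⊔ r) m>) m<s)
      where
      ⊔-lub-< : ∀ {p q r} → p < r → q < r → p ⊔ q < r
      ⊔-lub-< {p} {q} {r} p<r q<r = [ (λ e → subst (_< r) (sym e) p<r) , (λ e → subst (_< r) (sym e) q<r) ]′ (⊔-sel p q)
    decide (no ¬0<s) = let q , Lq = L-inhabited x in
      inj₁ (q , Lq , <2^-anti {r} {0ℚ} q (<⇒≤ (<-≤-trans r<s (≮⇒≥ ¬0<s))) (0<2^ q))

-- - δ < ε n < δ for all large n
TendsToZero : (ℕ → ℝ) → Set
TendsToZero ε = ∀ δ → 0ℚ < δ → ∃ λ N → ∀ n → N ℕ.≤ n → L (ε n) (- δ) × U (ε n) δ

{-# OPTIONS --safe #-}
-- Counting: the first two layers of an (n + 1)-quasigroup leave two symbols for layer 2 at each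
-- cell of Aⁿ.  In every direction each cell has a neighbour at which one of the missing symbols is
-- again missing, and then the choices at the two cells determine each other.  A class of mutually
-- determined cells thus has at least two cells on every line it meets, hence at least 2ⁿ cells, so
-- there are at most 2ⁿ classes and Q (n + 1) ≤ Q n ² · 2 ^ 2ⁿ.  Iterating from Q 0 = 4 gives c = 4.
-- Asymptotics: (n + 4) · 2ⁿ⁻¹ = 2 ^ (n + log₂ n − 1 + log₂ ((n + 4) / n)).
module Submission where

open import Defs using (Q; ℝ; _≃ℝ_; ℕ→ℝ; _+ℝ_; _-ℝ_; log₂ℕ; 2^_; TendsToZero)
open import Data.Nat.Base using (ℕ; _+_; _*_; _∸_; _^_; _≤_; NonZero)
open import Data.Product using (Σ-syntax; _×_)

open import Algebra.Bundles using (CommutativeRing)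
open import Data.Fin.Base using (Fin; zero; suc; punchOut)
open import Data.Fin.Patterns using (0F; 1F; 2F; 3F)
import Data.Fin.Properties as Fin
open import Data.Integer.Base as ℤ using (ℤ; +_; -[1+_])
import Data.Integer.Properties as ℤ
open import Data.List.Base
  using (List; []; _∷_; length; map; filter; cartesianProductWith; cartesianProduct; deduplicate; allFin)
open import Data.List.Membership.Propositional using (_∈_)
open import Data.List.Membership.Propositional.Properties using (∈-allFin)
import Data.List.Membership.Setoid.Properties as ∈ₛ
open import Data.List.Properties using (filter-++; length-++; length-map)
import Data.List.Relation.Binary.Sublist.Propositional.Properties as Sublist
open import Data.List.Relation.Binary.Sublist.Heterogeneous.Properties using (length-mono-≤)
open import Data.List.Relation.Unary.All as All using (All; []; _∷_)
import Data.List.Relation.Unary.All.Properties as All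
open import Data.List.Relation.Unary.AllPairs using (AllPairs; []; _∷_)
import Data.List.Relation.Unary.AllPairs.Properties as AllPairs
open import Data.List.Relation.Unary.Any as Any using (Any; here; there)
import Data.List.Relation.Unary.Any.Properties as Any
open import Data.List.Relation.Unary.Unique.DecSetoid.Properties using (deduplicate-!)
open import Data.Nat.Base using (zero; suc; z≤n; s≤s)
import Data.Nat.Properties as ℕ
import Data.Nat.Solver as ℕ
open import Data.Product using (∃; ∃₂; _,_; proj₁; proj₂; swap)
open import Data.Rational as ℚ using (ℚ; 0ℚ; 1ℚ; ½; Positive; positive; ↥_; ↧_; ↧ₙ_; toℚᵘ)
import Data.Rational.Properties as ℚ
import Data.Rational.Solver as ℚ
import Data.Rational.Unnormalised.Base as ℚᵘ
import Data.Rational.Unnormalised.Properties as ℚᵘ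
open import Data.Sum.Base using (_⊎_; inj₁; inj₂; [_,_]′)
open import Data.Vec.Base using (Vec; []; _∷_; lookup; _[_]≔_)
open import Data.Vec.Properties using ([]≔-lookup; lookup∘update; lookup∘update′)
import Data.Vec.Relation.Binary.Pointwise.Inductive as Pointwise
open import Defs using
  ( A; Operation; DifferInExactlyOne; IsQuasigroup; isQuasigroup?; tuples; vectors-complete; ∀tuple?
  ; operations; allOperations; allOperations-complete; allOperations-unique
  ; ℚ→ℝ; -ℝ_; log₂; pow2; 2ℚ; ℕ→ℚ; ℕ→ℚ-suc; 0≤ℕ→ℚ; _>2^_; _<2^_; 0<1; <-by; +-pos; *-pos
  ; *ʳ-mono-<; *ˡ-mono-<; x<y⇒0<y-x; inverse; archimedean; ^-pos; ^-mono-<; ^-mono-≤; ^-inverse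
  ; ^-open-above; pow2-suc; pow2-*; pow2-mono-<; 0<pow2; i+[1+k]; 0⊔-pos; >2^-/; <2^-/; >2^-lower
  ; 2^-between; neg-involutive )
open import Function.Base using (_∘_; flip)
open import Function.Bundles using (mk⇔; module Equivalence)
open import Function.Definitions using (Injective)
open import Level using (0ℓ)
open import Relation.Binary.Bundles using (DecSetoid)
open import Relation.Binary.Core using (Rel)
open import Relation.Binary.Definitions using (DecidableEquality)
open import Relation.Binary.PropositionalEquality as ≡
  using (_≡_; _≢_; refl; sym; trans; cong; cong₂; subst; subst₂)
open import Relation.Nullary using (¬_; Dec; yes; no; contradiction)
open import Relation.Nullary.Decidable using (¬?; _×-dec_; _→-dec_)
open import Relation.Unary using (Pred; Decidable; _⊆_)

open import Algebra.Properties.CommutativeSemiring.Exp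
  (CommutativeRing.commutativeSemiring ℚ.+-*-commutativeRing)
  using (^-assocʳ; ^-distrib-*) renaming (_^_ to _^ℚ_)

-- Counting with lists

private variable
  X Y Z : Set
  n : ℕ

#_⟨_⟩ : {P : Pred X 0ℓ} → List X → Decidable P → ℕ
# xs ⟨ P? ⟩ = length (filter P? xs)

module _ {P : Pred X 0ℓ} (P? : Decidable P) where

  length-filter-split : ∀ xs → length xs ≡ # xs ⟨ P? ⟩ + # xs ⟨ ¬? ∘ P? ⟩
  length-filter-split []       = refl
  length-filter-split (x ∷ xs) with P? x
  ... | yes _ = cong suc (length-filter-split xs)
  ... | no  _ = trans (cong suc (length-filter-split xs)) (sym (ℕ.+-suc _ _))

  length-filter-map : (f : Y → X) → ∀ ys → # map f ys ⟨ P? ⟩ ≡ # ys ⟨ P? ∘ f ⟩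
  length-filter-map f []       = refl
  length-filter-map f (y ∷ ys) with P? (f y)
  ... | yes _ = cong suc (length-filter-map f ys)
  ... | no  _ = length-filter-map f ys

  filter-filter : {R : Pred X 0ℓ} (R? : Decidable R) → P ⊆ R →
                  ∀ xs → filter P? (filter R? xs) ≡ filter P? xs
  filter-filter R? P⊆R []       = refl
  filter-filter R? P⊆R (x ∷ xs) with R? x | P? x in eq
  ... | yes _  | yes _ rewrite eq = cong (x ∷_) (filter-filter R? P⊆R xs)
  ... | yes _  | no _  rewrite eq = filter-filter R? P⊆R xs
  ... | no ¬rx | yes px = contradiction (P⊆R px) ¬rx
  ... | no _   | no _   = filter-filter R? P⊆R xs

  length-filter-filter : {R : Pred X 0ℓ} (R? : Decidable R) →
                         ∀ xs → # filter R? xs ⟨ P? ⟩ ≤ # xs ⟨ P? ⟩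
  length-filter-filter R? xs =
    length-mono-≤ (Sublist.filter⁺ P? P? (λ { refl Px → Px }) (Sublist.filter-⊆ R? xs))

length-cartesianProductWith : (f : X → Y → Z) → ∀ xs ys →
                              length (cartesianProductWith f xs ys) ≡ length xs * length ys
length-cartesianProductWith f []       ys = refl
length-cartesianProductWith f (x ∷ xs) ys =
  trans (length-++ (map (f x) ys))
        (cong₂ _+_ (length-map (f x) ys) (length-cartesianProductWith f xs ys))

module _ {P : Pred Z 0ℓ} (P? : Decidable P) (f : X → Y → Z) (ys : List Y) where

  private
    slice : X → ℕ
    slice x = # ys ⟨ P? ∘ f x ⟩

    split : ∀ x xs → # cartesianProductWith f (x ∷ xs) ys ⟨ P? ⟩ ≡
                     slice x + # cartesianProductWith f xs ys ⟨ P? ⟩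
    split x xs =
      trans (cong length (filter-++ P? (map (f x) ys) (cartesianProductWith f xs ys)))
     (trans (length-++ (filter P? (map (f x) ys)))
            (cong (_+ _) (length-filter-map P? (f x) ys)))

  slice≤product : ∀ {x xs} → x ∈ xs → slice x ≤ # cartesianProductWith f xs ys ⟨ P? ⟩
  slice≤product {x} {_ ∷ xs} (here refl) =
    subst (slice x ≤_) (sym (split x xs)) (ℕ.m≤m+n _ _)
  slice≤product {x} {y ∷ xs} (there x∈) =
    subst (slice x ≤_) (sym (split y xs)) (ℕ.≤-trans (slice≤product x∈) (ℕ.m≤n+m _ _))

  -- Different first coordinates occupy different positions of `xs`, so their blocks in the product
  -- are disjoint.
  slices≤product : ∀ {x y xs} → x ∈ xs → y ∈ xs → x ≢ y →
                   slice x + slice y ≤ # cartesianProductWith f xs ys ⟨ P? ⟩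
  slices≤product (here refl) (here refl) x≢y = contradiction refl x≢y
  slices≤product {x} {y} {_ ∷ xs} (here refl) (there y∈) _ =
    subst (slice x + slice y ≤_) (sym (split x xs)) (ℕ.+-monoʳ-≤ _ (slice≤product y∈))
  slices≤product {x} {y} {_ ∷ xs} (there x∈) (here refl) _ =
    subst₂ _≤_ (ℕ.+-comm (slice y) (slice x)) (sym (split y xs))
      (ℕ.+-monoʳ-≤ _ (slice≤product x∈))
  slices≤product {x} {y} {z ∷ xs} (there x∈) (there y∈) x≢y =
    subst (slice x + slice y ≤_) (sym (split z xs))
      (ℕ.≤-trans (slices≤product x∈ y∈ x≢y) (ℕ.m≤n+m _ _))

module _ {K : X → Y → Set} (K? : ∀ x y → Dec (K x y)) (m : ℕ) where

  -- Peel off the fibre of the first key: what remains is covered by the other keys, with fibres no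
  -- larger. Fibres may overlap, since an element is removed with the first key it meets.
  length≤fibres : ∀ xs ks → All (λ x → Any (K x) ks) xs →
                  (∀ k → # xs ⟨ flip K? k ⟩ ≤ m) → length xs ≤ length ks * m
  length≤fibres []      []       _       _  = z≤n
  length≤fibres (_ ∷ _) []       (() ∷ _) _
  length≤fibres xs      (k ∷ ks) covered small =
    subst (_≤ m + length ks * m) (sym (length-filter-split Kk? xs))
      (ℕ.+-mono-≤ (small k)
        (length≤fibres rest ks
          (All.zipWith (λ { (¬Kxk , here Kxk)  → contradiction Kxk ¬Kxk
                          ; (_    , there any) → any })
            (All.all-filter (¬? ∘ Kk?) xs , All.filter⁺ (¬? ∘ Kk?) covered))
          (λ k′ → ℕ.≤-trans (length-filter-filter (flip K? k′) (¬? ∘ Kk?) xs) (small k′))))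
    where
    Kk?  = flip K? k
    rest = filter (¬? ∘ Kk?) xs

module _ (D : DecSetoid 0ℓ 0ℓ) where
  open DecSetoid D using (Carrier; _≈_; _≟_) renaming (refl to ≈-refl; sym to ≈-sym; trans to ≈-trans)

  -- By transitivity, removing the class of `y` from `xs` takes nothing from the class of an
  -- inequivalent `y′`, so the classes can be counted off one at a time.
  inequivalent-classes≤length : ∀ {k} ys xs → AllPairs (λ y y′ → ¬ y ≈ y′) ys →
    All (λ y → k ≤ # xs ⟨ y ≟_ ⟩) ys → length ys * k ≤ length xs
  inequivalent-classes≤length []       xs []           []           = z≤n
  inequivalent-classes≤length {k} (y ∷ ys) xs (y≉ ∷ ys≉) (k≤ ∷ ks≤) =
    subst (k + length ys * k ≤_) (sym (length-filter-split (y ≟_) xs))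
      (ℕ.+-mono-≤ k≤ (inequivalent-classes≤length ys (filter (¬? ∘ (y ≟_)) xs) ys≉
        (All.zipWith (λ {y′} (y≉y′ , k≤) → subst (k ≤_)
            (cong length (sym (filter-filter (y′ ≟_) (¬? ∘ (y ≟_))
              (λ y′≈z y≈z → y≉y′ (≈-trans y≈z (≈-sym y′≈z))) xs))) k≤)
          (y≉ , ks≤))))

  representatives : ∀ k xs → (∀ x → k ≤ # xs ⟨ x ≟_ ⟩) →
    ∃ λ ys → length ys * k ≤ length xs × (∀ {x} → x ∈ xs → Any (_≈ x) ys)
  representatives k xs big = ys
    , inequivalent-classes≤length ys xs (deduplicate-! D xs) (All.tabulate (λ {y} _ → big y))
    , λ x∈ → Any.deduplicate⁺ _≟_ (λ z≈y y≈x → ≈-trans z≈y y≈x)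
               (Any.map (λ { refl → ≈-refl }) x∈)
    where ys = deduplicate _≟_ xs

AllPairs-with : {P : Pred X 0ℓ} {R S : Rel X 0ℓ} → (∀ {x y} → P x → P y → R x y → S x y) →
                ∀ {xs} → All P xs → AllPairs R xs → AllPairs S xs
AllPairs-with f []         []       = []
AllPairs-with f (px ∷ pxs) (r ∷ rs) =
  All.zipWith (λ (py , rxy) → f px py rxy) (pxs , r) ∷ AllPairs-with f pxs rs

module _ (_≟_ : DecidableEquality Y) (value : X → Z → Y) where

  private
    Agree : List Z → Rel X 0ℓ
    Agree ts x x′ = All (λ t → value x t ≡ value x′ t) ts

  -- Split by the outcome of the first test. Within a half that test is constant, so the remaining
  -- tests must separate the elements; once no tests are left, two elements would agree vacuously.
  length≤2^tests : ∀ ts xs → AllPairs (λ x x′ → ¬ Agree ts x x′) xs →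
    All (λ t → ∃₂ λ u v → All (λ x → value x t ≡ u ⊎ value x t ≡ v) xs) ts →
    length xs ≤ 2 ^ length ts
  length≤2^tests []       []          _                _ = z≤n
  length≤2^tests []       (_ ∷ [])    _                _ = s≤s z≤n
  length≤2^tests []       (_ ∷ _ ∷ _) ((¬agree ∷ _) ∷ _) _ = contradiction [] ¬agree
  length≤2^tests (t ∷ ts) xs apart ((u , v , two) ∷ twos) =
    subst₂ _≤_ (sym (length-filter-split u? xs)) (cong (λ k → 2 ^ length ts + k) (sym (ℕ.+-identityʳ _)))
      (ℕ.+-mono-≤ (half u? (All.all-filter u? xs))
                  (half (¬? ∘ u?) (All.zipWith (λ { (≢u , inj₁ ≡u) → contradiction ≡u ≢u
                                                  ; (_  , inj₂ ≡v) → ≡v })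
                                    (All.all-filter (¬? ∘ u?) xs , All.filter⁺ (¬? ∘ u?) two))))
    where
    u? : Decidable (λ x → value x t ≡ u)
    u? x = value x t ≟ u
    half : ∀ {w} {P : Pred X 0ℓ} (P? : Decidable P) →
           All (λ x → value x t ≡ w) (filter P? xs) → # xs ⟨ P? ⟩ ≤ 2 ^ length ts
    half P? ≡w = length≤2^tests ts (filter P? xs)
      (AllPairs-with (λ x≡w y≡w ¬agree agree → ¬agree (trans x≡w (sym y≡w) ∷ agree))
        ≡w (AllPairs.filter⁺ P? apart))
      (All.map (λ (u , v , two) → u , v , All.filter⁺ P? two) twos)

-- Completions of two layers of a quasigroup

-- If `y` were missed, `punchOut` at `y` would turn `f` into an injection into a set with one
-- element fewer.
injective⇒surjective : ∀ {n} {f : Fin n → Fin n} → Injective _≡_ _≡_ f → ∀ y → ∃ λ x → f x ≡ y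
injective⇒surjective {suc n} {f} inj y with Fin.any? (λ x → f x Fin.≟ y)
... | yes hit = hit
... | no miss = contradiction
  (λ {i j} eq → inj (Fin.punchOut-injective (avoid i) (avoid j) eq))
  (Fin.<⇒notInjective {f = λ x → punchOut (avoid x)} ℕ.≤-refl)
  where
  avoid : ∀ x → y ≢ f x
  avoid x y≡fx = miss (x , sym y≡fx)

line-differs : (c : Vec A n) (i : Fin n) {a b : A} → a ≢ b →
               DifferInExactlyOne (c [ i ]≔ a) (c [ i ]≔ b)
line-differs c i {a} {b} a≢b = i
  , (λ eq → a≢b (trans (sym (lookup∘update i c a)) (trans eq (lookup∘update i c b))))
  , only
  where
  only : ∀ {j} → lookup (c [ i ]≔ a) j ≢ lookup (c [ i ]≔ b) j → i ≡ j
  only {j} differ with i Fin.≟ j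
  ... | yes i≡j = i≡j
  ... | no  i≢j = contradiction
    (trans (lookup∘update′ (i≢j ∘ sym) c a) (sym (lookup∘update′ (i≢j ∘ sym) c b))) differ

line-injective : {q : Operation n} → IsQuasigroup q →
                 ∀ c i → Injective _≡_ _≡_ (λ a → q (c [ i ]≔ a))
line-injective h c i {a} {b} eq with a Fin.≟ b
... | yes a≡b = a≡b
... | no  a≢b = contradiction eq (h _ _ (line-differs c i a≢b))

layer-isQuasigroup : {q : Operation (suc n)} → IsQuasigroup q →
                     ∀ a → IsQuasigroup (λ c → q (a ∷ c))
layer-isQuasigroup h a c c′ (i , differ , only) = h (a ∷ c) (a ∷ c′)
  (suc i , differ , λ { {zero}  a≢a → contradiction refl a≢a
                      ; {suc j} differ′ → cong suc (only differ′) })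

-- Sets of cells that spread along every line

Spreading : Pred (Vec A n) 0ℓ → Set
Spreading {n} P = ∀ {c} → P c → ∀ (i : Fin n) → ∃ λ a → a ≢ lookup c i × P (c [ i ]≔ a)

-- Moving along the first coordinate gives a second slice that meets `P`. Both slices inherit
-- spreading in the other coordinates, so the bound doubles with each dimension.
spreading⇒2^n≤size : {P : Pred (Vec A n) 0ℓ} (P? : Decidable P) → Spreading P →
                     ∀ {c} → P c → 2 ^ n ≤ # tuples n ⟨ P? ⟩
spreading⇒2^n≤size {zero}  P? spread {[]} p with P? []
... | yes _ = s≤s z≤n
... | no ¬p = contradiction p ¬p
spreading⇒2^n≤size {suc n} {P} P? spread {a ∷ c} p =
  let b , b≢a , p′ = spread p zero in
  ℕ.≤-trans (ℕ.+-mono-≤ (slice a p)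
              (subst (_≤ # tuples n ⟨ P? ∘ (b ∷_) ⟩) (sym (ℕ.+-identityʳ (2 ^ n))) (slice b p′)))
            (slices≤product P? _∷_ (tuples n) (∈-allFin a) (∈-allFin b) (b≢a ∘ sym))
  where
  slice : ∀ a → P (a ∷ c) → 2 ^ n ≤ # tuples n ⟨ P? ∘ (a ∷_) ⟩
  slice a = spreading⇒2^n≤size (P? ∘ (a ∷_)) (λ p i → spread p (suc i))

-- Writing 4ⁿ as 2ⁿ · 2ⁿ lets `length-tests` cancel one factor against the size of a class.
length-tuples : ∀ n → length (tuples n) ≡ 2 ^ n * 2 ^ n
length-tuples zero    = refl
length-tuples (suc n) =
  trans (length-cartesianProductWith _∷_ (allFin 4) (tuples n))
 (trans (cong (4 *_) (length-tuples n))
        (solve 1 (λ t → con 4 :* (t :* t) := con 2 :* t :* (con 2 :* t)) refl (2 ^ n)))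
  where open ℕ.+-*-Solver

∈-tuples : (c : Vec A n) → c ∈ tuples n
∈-tuples {n} c = Any.map Pointwise.Pointwise-≡⇒≡ (vectors-complete (≡.setoid A) ∈-allFin n c)

-- Quasigroups that share their first two layers

column-injective : {q : Operation (suc n)} → IsQuasigroup q →
                   ∀ c {a b} → q (a ∷ c) ≡ q (b ∷ c) → a ≡ b
-- A column is a line in coordinate 0; the entry `0F` is overwritten at once.
column-injective h c = line-injective h (0F ∷ c) zero

LikeIn01 : Rel (Operation (suc n)) 0ℓ
LikeIn01 p q = ∀ c → q (0F ∷ c) ≡ p (0F ∷ c) × q (1F ∷ c) ≡ p (1F ∷ c)

-- A symbol e missing from layers 0 and 1 at both of two adjacent cells must, at each of these
-- cells, be used in layer 2 or in layer 3, and not twice in the same layer.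
module _ {q : Operation (suc n)} (h : IsQuasigroup q) (e : A) where

  Absent : Vec A n → Set
  Absent c = q (0F ∷ c) ≢ e × q (1F ∷ c) ≢ e

  absent⇒in-2-or-3 : ∀ {c} → Absent c → q (2F ∷ c) ≡ e ⊎ q (3F ∷ c) ≡ e
  absent⇒in-2-or-3 {c} (0≢ , 1≢) with injective⇒surjective (column-injective h c) e
  ... | 0F , eq = contradiction eq 0≢
  ... | 1F , eq = contradiction eq 1≢
  ... | 2F , eq = inj₁ eq
  ... | 3F , eq = inj₂ eq

  absent⇒in-2 : ∀ {c c′} → (∀ a → q (a ∷ c) ≢ q (a ∷ c′)) →
                Absent c → Absent c′ → q (2F ∷ c′) ≢ e → q (2F ∷ c) ≡ e
  absent⇒in-2 adjacent absent absent′ ≢e with absent⇒in-2-or-3 absent | absent⇒in-2-or-3 absent′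
  ... | inj₁ eq | _        = eq
  ... | inj₂ _  | inj₁ eq  = contradiction eq ≢e
  ... | inj₂ eq | inj₂ eq′ = contradiction (trans eq (sym eq′)) (adjacent _)

-- `p` is a base point for the family `F`: each member is recorded by the cells at which its layer 2
-- takes the symbol from layer 2 of `p`; at the other cells it takes the one from layer 3.
module Completions
  {p : Operation (suc n)} (p-quasi : IsQuasigroup p)
  (F : List (Operation (suc n)))
  (quasi : All IsQuasigroup F) (like : All (LikeIn01 p) F)
  where

  -- The symbol occurs somewhere in the column of `p` over `c`. Layers 0 and 1 are ruled out: `q`
  -- has the same symbols there and repeats none in a column.
  two-values : ∀ {q} → q ∈ F → ∀ c → q (2F ∷ c) ≡ p (2F ∷ c) ⊎ q (2F ∷ c) ≡ p (3F ∷ c)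
  two-values {q} q∈ c with injective⇒surjective (column-injective p-quasi c) (q (2F ∷ c))
  ... | 0F , eq = contradiction (column-injective (All.lookup quasi q∈) c
                    (trans (proj₁ (All.lookup like q∈ c)) eq)) λ ()
  ... | 1F , eq = contradiction (column-injective (All.lookup quasi q∈) c
                    (trans (proj₂ (All.lookup like q∈ c)) eq)) λ ()
  ... | 2F , eq = inj₁ (sym eq)
  ... | 3F , eq = inj₂ (sym eq)

  Same : Operation (suc n) → Vec A n → Set
  Same q c = q (2F ∷ c) ≡ p (2F ∷ c)

  -- Mutual determination is taken semantically, over all members of the finite list `F`, rather
  -- than generated by links between neighbours; hence it is visibly a decidable equivalence.
  _≈_ : Rel (Vec A n) 0ℓ
  c ≈ c′ = All (λ q → (Same q c → Same q c′) × (Same q c′ → Same q c)) F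

  cells : DecSetoid 0ℓ 0ℓ
  cells = record
    { Carrier = Vec A n
    ; _≈_     = _≈_
    ; isDecEquivalence = record
      { isEquivalence = record
        { refl  = All.tabulate λ _ → (λ s → s) , (λ s → s)
        ; sym   = All.map swap
        ; trans = λ e f → All.zipWith (λ ((to , from) , (to′ , from′)) → to′ ∘ to , from ∘ from′) (e , f)
        }
      ; _≟_ = λ c c′ → All.all? (λ q → (same? q c →-dec same? q c′) ×-dec (same? q c′ →-dec same? q c)) F
      }
    }
    where
    same? : ∀ q c → Dec (Same q c)
    same? q c = q (2F ∷ c) Fin.≟ p (2F ∷ c)

  open DecSetoid cells using (_≟_) renaming (refl to ≈-refl; sym to ≈-sym; trans to ≈-trans)

  Adjacent : Rel (Vec A n) 0ℓ
  Adjacent c c′ = ∀ {q} → IsQuasigroup q → ∀ a → q (a ∷ c) ≢ q (a ∷ c′)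

  line-adjacent : ∀ c i {a} → a ≢ lookup c i → Adjacent c (c [ i ]≔ a)
  line-adjacent c i a≢ {q} h b eq = a≢ (sym (line-injective h (b ∷ c) (suc i)
    (trans (cong (λ v → q (b ∷ v)) ([]≔-lookup c i)) eq)))

  AbsentInp : A → Pred (Vec A n) 0ℓ
  AbsentInp = Absent p-quasi

  absent-like : ∀ {q e c} (q∈ : q ∈ F) → AbsentInp e c → Absent (All.lookup quasi q∈) e c
  absent-like {c = c} q∈ (0≢ , 1≢) =
    let eq₀ , eq₁ = All.lookup like q∈ c in 0≢ ∘ trans (sym eq₀) , 1≢ ∘ trans (sym eq₁)

  -- Every member has `e` in layer 2 at exactly one of the two cells. For `p` this cell is `c`, so a
  -- member follows `p` at `c` exactly when it has `e` in layer 2 there, and follows `p` at `c′`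
  -- exactly when it does not have `e` in layer 2 there.
  forced : ∀ {c c′ e} → Adjacent c c′ → AbsentInp e c → AbsentInp e c′ → p (2F ∷ c) ≡ e → c ≈ c′
  forced {c} {c′} {e} adjacent absent absent′ p₂c≡e = All.tabulate λ {q} q∈ → to q∈ , from q∈
    where
    p₂c′≢e : p (2F ∷ c′) ≢ e
    p₂c′≢e eq = adjacent p-quasi 2F (trans p₂c≡e (sym eq))
    p₃c′≡e : p (3F ∷ c′) ≡ e
    p₃c′≡e with absent⇒in-2-or-3 p-quasi e absent′
    ... | inj₁ eq = contradiction eq p₂c′≢e
    ... | inj₂ eq = eq
    to : ∀ {q} → q ∈ F → Same q c → Same q c′
    to q∈ same with two-values q∈ c′
    ... | inj₁ eq = eq
    ... | inj₂ eq = contradiction (trans same (trans p₂c≡e (sym (trans eq p₃c′≡e))))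
                                  (adjacent (All.lookup quasi q∈) 2F)
    from : ∀ {q} → q ∈ F → Same q c′ → Same q c
    from q∈ same = trans
      (absent⇒in-2 (All.lookup quasi q∈) e (adjacent (All.lookup quasi q∈))
        (absent-like q∈ absent) (absent-like q∈ absent′) (p₂c′≢e ∘ trans (sym same)))
      (sym p₂c≡e)

  -- Choosing the neighbour c′ of c with p (1 ∷ c′) = p (0 ∷ c), at most three symbols occur in
  -- layers 0 and 1 at c and c′.
  link : ∀ c i → ∃ λ a → a ≢ lookup c i × c ≈ (c [ i ]≔ a)
  link c i = a , a≢ , linked (proj₁ b,eq) (proj₂ b,eq)
    where
    a,eq = injective⇒surjective (line-injective p-quasi (1F ∷ c) (suc i)) (p (0F ∷ c))
    a    = proj₁ a,eq
    c′   = c [ i ]≔ a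
    p₁c′≡p₀c : p (1F ∷ c′) ≡ p (0F ∷ c)
    p₁c′≡p₀c = proj₂ a,eq

    -- With the coordinate unchanged, layers 0 and 1 of `p` would hold the same symbol at `c`.
    a≢ : a ≢ lookup c i
    a≢ a≡ = contradiction
      (column-injective p-quasi c
        (trans (cong (λ v → p (1F ∷ v)) (sym (trans (cong (c [ i ]≔_) a≡) ([]≔-lookup c i)))) p₁c′≡p₀c))
      λ ()

    -- The layer in which the possible third symbol, `p (0F ∷ c′)`, stands over `c`; it tells which
    -- symbol missing at `c` is missing at `c′` too.
    b,eq = injective⇒surjective (column-injective p-quasi c) (p (0F ∷ c′))

    adjacent : Adjacent c c′
    adjacent = line-adjacent c i a≢

    column-≢ : ∀ {d d′} → d ≢ d′ → p (d ∷ c) ≢ p (d′ ∷ c)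
    column-≢ d≢d′ eq = d≢d′ (column-injective p-quasi c eq)

    absent : ∀ d → 0F ≢ d → 1F ≢ d → AbsentInp (p (d ∷ c)) c
    absent d 0≢d 1≢d = column-≢ 0≢d , column-≢ 1≢d

    absent′ : ∀ {b} → p (b ∷ c) ≡ p (0F ∷ c′) → ∀ d → 0F ≢ d → b ≢ d → AbsentInp (p (d ∷ c)) c′
    absent′ eq d 0≢d b≢d = column-≢ b≢d ∘ trans eq , column-≢ 0≢d ∘ trans (sym p₁c′≡p₀c)

    via₂ : ∀ {b} → p (b ∷ c) ≡ p (0F ∷ c′) → b ≢ 2F → c ≈ c′
    via₂ eq b≢2 = forced adjacent (absent 2F (λ ()) (λ ())) (absent′ eq 2F (λ ()) b≢2) refl

    linked : ∀ b → p (b ∷ c) ≡ p (0F ∷ c′) → c ≈ c′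
    linked 0F eq = via₂ eq λ ()
    linked 1F eq = via₂ eq λ ()
    linked 3F eq = via₂ eq λ ()
    -- Now `p (2F ∷ c)` is used at `c′`, so the shared missing symbol is `p (3F ∷ c)`. It stands in
    -- layer 3 at `c`, hence in layer 2 at `c′`, and `forced` applies with the cells exchanged.
    linked 2F eq = ≈-sym (forced (λ h a → adjacent h a ∘ sym) absent₃′ absent₃
      (absent⇒in-2 p-quasi _ (λ a → adjacent p-quasi a ∘ sym) absent₃′ absent₃ (column-≢ λ ())))
      where
      absent₃  = absent 3F (λ ()) (λ ())
      absent₃′ = absent′ eq 3F (λ ()) (λ ())

  class-spreading : ∀ c → Spreading (c ≈_)
  class-spreading c {d} c≈d i = let a , a≢ , d≈ = link d i in a , a≢ , ≈-trans c≈d d≈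

  private
    reps = representatives cells (2 ^ n) (tuples n)
      (λ c → spreading⇒2^n≤size (c ≟_) (class-spreading c) {c} ≈-refl)
    tests : List (Vec A n)
    tests = proj₁ reps

  length-tests : length tests ≤ 2 ^ n
  length-tests = ℕ.*-cancelʳ-≤ _ _ (2 ^ n) ⦃ ℕ.m^n≢0 2 n ⦄
    (subst (length tests * 2 ^ n ≤_) (length-tuples n) (proj₁ (proj₂ reps)))

  -- Every cell is equivalent to a test, and for both members the choice between the two symbols is
  -- carried from the test to the cell.
  agree-on-tests : ∀ {q q′} → q ∈ F → q′ ∈ F →
    All (λ t → q (2F ∷ t) ≡ q′ (2F ∷ t)) tests → ∀ c → q (2F ∷ c) ≡ q′ (2F ∷ c)
  agree-on-tests {q} {q′} q∈ q′∈ agree c =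
    All.lookupWith agree-at agree (proj₂ (proj₂ reps) (∈-tuples c))
    where
    agree-at : ∀ {t} → q (2F ∷ t) ≡ q′ (2F ∷ t) → t ≈ c → q (2F ∷ c) ≡ q′ (2F ∷ c)
    agree-at agree t≈c with two-values q∈ c | two-values q′∈ c
    ... | inj₁ eq | inj₁ eq′ = trans eq (sym eq′)
    ... | inj₂ eq | inj₂ eq′ = trans eq (sym eq′)
    ... | inj₁ eq | inj₂ _   = trans eq (sym (proj₁ (All.lookup t≈c q′∈)
                                 (trans (sym agree) (proj₂ (All.lookup t≈c q∈) eq))))
    ... | inj₂ _  | inj₁ eq′ = trans (proj₁ (All.lookup t≈c q∈)
                                 (trans agree (proj₂ (All.lookup t≈c q′∈) eq′))) (sym eq′)

  -- Layer 3 holds the one symbol left over: its symbol under `q′` occurs in the column of `q`, and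
  -- not in layers 0 to 2, where the columns coincide.
  agree⇒equal : ∀ {q q′} → q ∈ F → q′ ∈ F →
    (∀ c → q (2F ∷ c) ≡ q′ (2F ∷ c)) → ∀ c → q c ≡ q′ c
  agree⇒equal q∈ q′∈ agree (0F ∷ c) =
    trans (proj₁ (All.lookup like q∈ c)) (sym (proj₁ (All.lookup like q′∈ c)))
  agree⇒equal q∈ q′∈ agree (1F ∷ c) =
    trans (proj₂ (All.lookup like q∈ c)) (sym (proj₂ (All.lookup like q′∈ c)))
  agree⇒equal q∈ q′∈ agree (2F ∷ c) = agree c
  agree⇒equal {q} {q′} q∈ q′∈ agree (3F ∷ c)
    with injective⇒surjective (column-injective (All.lookup quasi q∈) c) (q′ (3F ∷ c))
  ... | 3F , eq = eq
  ... | 0F , eq = contradiction (column-injective (All.lookup quasi q′∈) c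
                    (trans (sym (agree⇒equal q∈ q′∈ agree (0F ∷ c))) eq)) λ ()
  ... | 1F , eq = contradiction (column-injective (All.lookup quasi q′∈) c
                    (trans (sym (agree⇒equal q∈ q′∈ agree (1F ∷ c))) eq)) λ ()
  ... | 2F , eq = contradiction (column-injective (All.lookup quasi q′∈) c
                    (trans (sym (agree c)) eq)) λ ()

  -- Distinct members differ in layer 2 at some test, and `two-values` leaves two outcomes for each
  -- test.
  length-completions : AllPairs (λ q q′ → ¬ (∀ c → q c ≡ q′ c)) F → length F ≤ 2 ^ 2 ^ n
  length-completions unique = ℕ.≤-trans
    (length≤2^tests Fin._≟_ (λ q t → q (2F ∷ t)) tests F
      (AllPairs-with (λ q∈ q′∈ q≉q′ agree → q≉q′ (agree⇒equal q∈ q′∈ (agree-on-tests q∈ q′∈ agree)))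
        (All.tabulate (λ q∈ → q∈)) unique)
      (All.tabulate (λ {t} _ → p (2F ∷ t) , p (3F ∷ t) , All.tabulate (λ q∈ → two-values q∈ t))))
    (ℕ.^-monoʳ-≤ 2 length-tests)

-- The recursion for `Q` and the resulting bound

quasigroupList : ∀ n → List (Operation n)
quasigroupList n = filter isQuasigroup? (allOperations n)

FirstLayers : Operation (suc n) → Operation n × Operation n → Set
FirstLayers q (r₀ , r₁) = (∀ c → q (0F ∷ c) ≡ r₀ c) × (∀ c → q (1F ∷ c) ≡ r₁ c)

firstLayers? : ∀ (q : Operation (suc n)) r → Dec (FirstLayers q r)
firstLayers? q (r₀ , r₁) =
  ∀tuple? (λ c → q (0F ∷ c) Fin.≟ r₀ c) ×-dec ∀tuple? (λ c → q (1F ∷ c) Fin.≟ r₁ c)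

∈-quasigroupList : {q : Operation n} → IsQuasigroup q → Any (λ r → ∀ c → q c ≡ r c) (quasigroupList n)
∈-quasigroupList {n} {q} h =
  ∈ₛ.∈-filter⁺ (operations n) isQuasigroup? respects (allOperations-complete n q) h
  where
  respects : ∀ {q r : Operation n} → (∀ c → q c ≡ r c) → IsQuasigroup q → IsQuasigroup r
  respects eq h c c′ d rc≡rc′ = h c c′ d (trans (eq c) (trans rc≡rc′ (sym (eq c′))))

-- Sort the (n + 1)-quasigroups by layers 0 and 1, which are themselves n-quasigroups; each fibre is
-- a family of completions.
Q-suc : ∀ n → Q (suc n) ≤ Q n * Q n * 2 ^ 2 ^ n
Q-suc n = subst (λ k → Q (suc n) ≤ k * 2 ^ 2 ^ n)
  (length-cartesianProductWith _,_ (quasigroupList n) (quasigroupList n))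
  (length≤fibres firstLayers? (2 ^ 2 ^ n) qs (cartesianProduct (quasigroupList n) (quasigroupList n))
    (All.map covered all-quasi) small)
  where
  qs = quasigroupList (suc n)
  all-quasi : All IsQuasigroup qs
  all-quasi = All.all-filter isQuasigroup? (allOperations (suc n))
  covered : ∀ {q} → IsQuasigroup q →
            Any (FirstLayers q) (cartesianProduct (quasigroupList n) (quasigroupList n))
  covered h = Any.cartesianProduct⁺ (∈-quasigroupList (layer-isQuasigroup h 0F))
                                    (∈-quasigroupList (layer-isQuasigroup h 1F))
  small : ∀ r → # qs ⟨ flip firstLayers? r ⟩ ≤ 2 ^ 2 ^ n
  small r = bound (filter (flip firstLayers? r) qs)
    (All.all-filter (flip firstLayers? r) qs)
    (All.filter⁺ (flip firstLayers? r) all-quasi)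
    (AllPairs.filter⁺ (flip firstLayers? r)
      (AllPairs.filter⁺ isQuasigroup? (allOperations-unique (suc n))))
    where
    bound : ∀ F → All (λ q → FirstLayers q r) F → All IsQuasigroup F →
            AllPairs (λ q q′ → ¬ (∀ c → q c ≡ q′ c)) F → length F ≤ 2 ^ 2 ^ n
    bound []      _       _       _      = z≤n
    -- The first member of a nonempty fibre serves as the base point.
    bound (p ∷ F) (fp ∷ fs) (hp ∷ hs) unique =
      Completions.length-completions hp (p ∷ F) (hp ∷ hs) (All.map (λ {q} → like {q}) (fp ∷ fs)) unique
      where
      like : ∀ {q} → FirstLayers q r → LikeIn01 p q
      like (q₀ , q₁) c = trans (q₀ c) (sym (proj₁ fp c)) , trans (q₁ c) (sym (proj₂ fp c))

-- The induction carries the square, the quantity that `Q-suc` consumes; this avoids the factor 2ⁿ⁻¹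
-- at n = 0.
Q²-bound : ∀ n → Q n * Q n ≤ 2 ^ ((n + 4) * 2 ^ n)
Q-bound-suc : ∀ n → Q (suc n) ≤ 2 ^ ((suc n + 4) * 2 ^ n)

-- `Q 0` is 4, so both sides are 16; this is where the constant 4 comes from.
Q²-bound zero    = ℕ.≤-refl
Q²-bound (suc n) = subst (Q (suc n) * Q (suc n) ≤_)
  (trans (sym (ℕ.^-distribˡ-+-* 2 k k)) (cong (2 ^_) (eq (suc n + 4) (2 ^ n))))
  (ℕ.*-mono-≤ (Q-bound-suc n) (Q-bound-suc n))
  where
  k = (suc n + 4) * 2 ^ n
  eq : ∀ m t → m * t + m * t ≡ m * (2 * t)
  eq = solve 2 (λ m t → m :* t :+ m :* t := m :* (con 2 :* t)) refl
    where open ℕ.+-*-Solver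

-- The exponents add up as (n + 4) · 2ⁿ + 2ⁿ = (n + 5) · 2ⁿ.
Q-bound-suc n = subst (Q (suc n) ≤_)
  (trans (sym (ℕ.^-distribˡ-+-* 2 ((n + 4) * 2 ^ n) (2 ^ n)))
         (cong (2 ^_) (ℕ.+-comm ((n + 4) * 2 ^ n) (2 ^ n))))
  (ℕ.≤-trans (Q-suc n) (ℕ.*-monoˡ-≤ (2 ^ 2 ^ n) (Q²-bound n)))

-- Binary logarithms and powers of Dedekind reals

open ℚ.+-*-Solver using (solve; _:+_; _:*_; _:-_; :-_; _:=_; con)
open ℝ

-- One inclusion of the cuts suffices, since a strictly smaller lower cut leaves a gap in which
-- locatedness fails.
≃ℝ-intro : ∀ x y → (∀ {q} → L x q → L y q) → (∀ {q} → U x q → U y q) → x ≃ℝ y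
≃ℝ-intro x y L⇒ U⇒ = (λ q → mk⇔ L⇒ L⇐) , (λ q → mk⇔ U⇒ U⇐)
  where
  L⇐ : ∀ {q} → L y q → L x q
  L⇐ Lq = let r , q<r , Lr = L-open y Lq in
    [ (λ Lq → Lq) , (λ Ur → contradiction (U⇒ Ur) (disjoint y Lr)) ]′ (located x q<r)
  U⇐ : ∀ {q} → U y q → U x q
  U⇐ Uq = let r , r<q , Ur = U-open y Uq in
    [ (λ Lr → contradiction Ur (disjoint y (L⇒ Lr))) , (λ Uq → Uq) ]′ (located x r<q)

module _ {x y : ℝ} (x≃y : x ≃ℝ y) where
  L-resp : ∀ {q} → L x q → L y q
  L-resp {q} = Equivalence.to (proj₁ x≃y q)
  U-resp : ∀ {q} → U x q → U y q
  U-resp {q} = Equivalence.to (proj₂ x≃y q)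

≃ℝ-reflexive : ∀ {x y} → x ≡ y → x ≃ℝ y
≃ℝ-reflexive {x} refl = ≃ℝ-intro x x (λ l → l) (λ u → u)

≃ℝ-sym : ∀ {x y} → x ≃ℝ y → y ≃ℝ x
≃ℝ-sym {x} {y} (l , u) = ≃ℝ-intro y x (λ {q} → Equivalence.from (l q)) (λ {q} → Equivalence.from (u q))

≃ℝ-trans : ∀ {x y z} → x ≃ℝ y → y ≃ℝ z → x ≃ℝ z
≃ℝ-trans {x} {y} {z} e f =
  ≃ℝ-intro x z (L-resp {y} {z} f ∘ L-resp {x} {y} e) (U-resp {y} {z} f ∘ U-resp {x} {y} e)

+ℝ-cong : ∀ {x y u v} → x ≃ℝ y → u ≃ℝ v → x +ℝ u ≃ℝ y +ℝ v
+ℝ-cong {x} {y} {u} {v} e f = ≃ℝ-intro (x +ℝ u) (y +ℝ v)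
  (λ (a , b , La , Lb , eq) → a , b , L-resp {x} {y} e La , L-resp {u} {v} f Lb , eq)
  (λ (a , b , Ua , Ub , eq) → a , b , U-resp {x} {y} e Ua , U-resp {u} {v} f Ub , eq)

2^-cong : ∀ {x y} → x ≃ℝ y → 2^ x ≃ℝ 2^ y
2^-cong {x} {y} e = ≃ℝ-intro (2^ x) (2^ y)
  (λ (q , Lq , r<) → q , L-resp {x} {y} e Lq , r<)
  (λ (q , Uq , r>) → q , U-resp {x} {y} e Uq , r>)

-ℝ-ℚ→ℝ : ∀ p → -ℝ ℚ→ℝ p ≃ℝ ℚ→ℝ (ℚ.- p)
-ℝ-ℚ→ℝ p = ≃ℝ-intro (-ℝ ℚ→ℝ p) (ℚ→ℝ (ℚ.- p))
  (λ {q} p<-q → subst (ℚ._< ℚ.- p) (neg-involutive q) (ℚ.neg-antimono-< p<-q))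
  (λ {q} -q<p → subst (ℚ.- p ℚ.<_) (neg-involutive q) (ℚ.neg-antimono-< -q<p))

-- Membership of `r` in a cut of the left side exhibits a power 2 ^ q strictly between `r` and `p`.
2^-log₂ : ∀ p .⦃ _ : Positive p ⦄ → 2^ log₂ p ≃ℝ ℚ→ℝ p
2^-log₂ p = ≃ℝ-intro (2^ log₂ p) (ℚ→ℝ p)
  (λ {r} (q , p> , r<) → 2^-between {r} {p} q r< p>)
  (λ {r} (q , p< , r>) → 2^-between {p} {r} q p< r>)

-- Additivity of the binary logarithm

*-mono-<-pos : ∀ {a b c d} → 0ℚ ℚ.< b → 0ℚ ℚ.< c → a ℚ.< b → c ℚ.< d → a ℚ.* c ℚ.< b ℚ.* d
*-mono-<-pos {a} {b} {c} {d} 0<b 0<c a<b c<d =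
  ℚ.<-trans (*ʳ-mono-< {a} {b} {c} 0<c a<b) (*ˡ-mono-< {c} {d} {b} 0<b c<d)

pow2-+ : ∀ i j → pow2 (i ℤ.+ j) ≡ pow2 i ℚ.* pow2 j
pow2-+ i (+ n) = go i n
  where
  go : ∀ i n → pow2 (i ℤ.+ + n) ≡ pow2 i ℚ.* 2ℚ ^ℚ n
  go i zero    = trans (cong pow2 (ℤ.+-identityʳ i)) (sym (ℚ.*-identityʳ (pow2 i)))
  go i (suc n) = trans (cong pow2 (i+[1+k] i (+ n)))
                (trans (go (ℤ.suc i) n)
                (trans (cong (ℚ._* 2ℚ ^ℚ n) (pow2-suc i))
                       (solve 3 (λ a b c → a :* b :* c := b :* (a :* c)) refl 2ℚ (pow2 i) (2ℚ ^ℚ n))))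
-- Multiply and divide by 2ⁿ⁺¹; the nonnegative case, applied to i - (n + 1), recovers `pow2 i`.
pow2-+ i -[1+ n ] = trans (sym (trans (ℚ.*-assoc s (2ℚ ^ℚ suc n) (½ ^ℚ suc n))
                       (trans (cong (s ℚ.*_) (^-inverse {2ℚ} {½} refl (suc n))) (ℚ.*-identityʳ s))))
                       (cong (ℚ._* ½ ^ℚ suc n) (sym pow2-i))
  where
  s = pow2 (i ℤ.+ -[1+ n ])
  pow2-i : pow2 i ≡ s ℚ.* 2ℚ ^ℚ suc n
  pow2-i = trans (cong pow2 (sym (trans (ℤ.+-assoc i -[1+ n ] (+ suc n))
                                 (trans (cong (λ j → i ℤ.+ j) (ℤ.+-inverseˡ (+ suc n))) (ℤ.+-identityʳ i)))))
                 (pow2-+ (i ℤ.+ -[1+ n ]) (+ suc n))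

module _ {p q} (0<p : 0ℚ ℚ.< p) (0<q : 0ℚ ℚ.< q) where
  private
    ^-product : ∀ d e → (p ^ℚ d) ^ℚ e ℚ.* (q ^ℚ e) ^ℚ d ≡ (0ℚ ℚ.⊔ p ℚ.* q) ^ℚ (d * e)
    ^-product d e =
      trans (cong₂ ℚ._*_ (^-assocʳ p d e) (trans (^-assocʳ q e d) (cong (q ^ℚ_) (ℕ.*-comm e d))))
     (trans (sym (^-distrib-* p q (d * e))) (cong (_^ℚ (d * e)) (sym (0⊔-pos (*-pos 0<p 0<q)))))

    pow2-product : ∀ i d j e → pow2 i ^ℚ e ℚ.* pow2 j ^ℚ d ≡ pow2 (i ℤ.* + e ℤ.+ j ℤ.* + d)
    pow2-product i d j e = trans (cong₂ ℚ._*_ (sym (pow2-* i e)) (sym (pow2-* j d)))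
                                 (sym (pow2-+ (i ℤ.* + e) (j ℤ.* + d)))

  -- Write the exponents as i / d and j / e. Raising p ^ d > 2 ^ i to the power e and q ^ e > 2 ^ j
  -- to the power d, then multiplying, compares (p q) ^ (d e) with 2 ^ (i e + j d).
  >2^-* : ∀ a b → p >2^ a → q >2^ b → (p ℚ.* q) >2^ (a ℚ.+ b)
  >2^-* a@record{} b@record{} p> q> = >2^-/ (p ℚ.* q) (↥ a ℤ.* ↧ b ℤ.+ ↥ b ℤ.* ↧ a) (↧ₙ a * ↧ₙ b)
    (subst₂ ℚ._<_ (pow2-product (↥ a) (↧ₙ a) (↥ b) (↧ₙ b)) (^-product (↧ₙ a) (↧ₙ b))
      (*-mono-<-pos (^-pos (^-pos 0<p (↧ₙ a)) (↧ₙ b)) (^-pos (0<pow2 (↥ b)) (↧ₙ a))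
        (^-mono-< (ℚ.<⇒≤ (0<pow2 (↥ a))) (subst (λ z → pow2 (↥ a) ℚ.< z ^ℚ ↧ₙ a) (0⊔-pos 0<p) p>) (↧ₙ b))
        (^-mono-< (ℚ.<⇒≤ (0<pow2 (↥ b))) (subst (λ z → pow2 (↥ b) ℚ.< z ^ℚ ↧ₙ b) (0⊔-pos 0<q) q>) (↧ₙ a))))

  <2^-* : ∀ a b → p <2^ a → q <2^ b → (p ℚ.* q) <2^ (a ℚ.+ b)
  <2^-* a@record{} b@record{} p< q< = <2^-/ (p ℚ.* q) (↥ a ℤ.* ↧ b ℤ.+ ↥ b ℤ.* ↧ a) (↧ₙ a * ↧ₙ b)
    (subst₂ ℚ._<_ (^-product (↧ₙ a) (↧ₙ b)) (pow2-product (↥ a) (↧ₙ a) (↥ b) (↧ₙ b))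
      (*-mono-<-pos (^-pos (0<pow2 (↥ a)) (↧ₙ b)) (^-pos (^-pos 0<q (↧ₙ b)) (↧ₙ a))
        (^-mono-< (ℚ.<⇒≤ (^-pos 0<p (↧ₙ a))) (subst (λ z → z ^ℚ ↧ₙ a ℚ.< pow2 (↥ a)) (0⊔-pos 0<p) p<) (↧ₙ b))
        (^-mono-< (ℚ.<⇒≤ (^-pos 0<q (↧ₙ b))) (subst (λ z → z ^ℚ ↧ₙ b ℚ.< pow2 (↥ b)) (0⊔-pos 0<q) q<) (↧ₙ a))))

log₂-* : ∀ p q .⦃ _ : Positive p ⦄ .⦃ _ : Positive q ⦄ .⦃ _ : Positive (p ℚ.* q) ⦄ →
         log₂ p +ℝ log₂ q ≃ℝ log₂ (p ℚ.* q)
log₂-* p q = ≃ℝ-intro (log₂ p +ℝ log₂ q) (log₂ (p ℚ.* q))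
  (λ { (a , b , La , Lb , refl) → >2^-* {p} {q} 0<p 0<q a b La Lb })
  (λ { (a , b , Ua , Ub , refl) → <2^-* {p} {q} 0<p 0<q a b Ua Ub })
  where
  0<p : 0ℚ ℚ.< p
  0<p = ℚ.positive⁻¹ p
  0<q : 0ℚ ℚ.< q
  0<q = ℚ.positive⁻¹ q

-- Comparing a / b with i means comparing a with i b, hence, `pow2` being strictly increasing, 2 ^ a
-- with (2 ^ i) ^ b, as in the cuts of the logarithm.
ℤ≃log₂-pow2 : ∀ i .⦃ _ : Positive (pow2 i) ⦄ → ℚ→ℝ (i ℚ./ 1) ≃ℝ log₂ (pow2 i)
ℤ≃log₂-pow2 i = ≃ℝ-intro (ℚ→ℝ (i ℚ./ 1)) (log₂ (pow2 i))
  (λ {q} q<i → subst (pow2 (↥ q) ℚ.<_) (power q) (pow2-mono-< (below q q<i)))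
  (λ {q} i<q → subst (ℚ._< pow2 (↥ q)) (power q) (pow2-mono-< (above q i<q)))
  where
  power : ∀ q → pow2 (i ℤ.* ↧ q) ≡ (0ℚ ℚ.⊔ pow2 i) ^ℚ ↧ₙ q
  power q = trans (pow2-* i (↧ₙ q)) (cong (_^ℚ ↧ₙ q) (sym (0⊔-pos (0<pow2 i))))
  i/1≃i : toℚᵘ (i ℚ./ 1) ℚᵘ.≃ ℚᵘ.mkℚᵘ i 0
  i/1≃i = ℚ.toℚᵘ-fromℚᵘ (ℚᵘ.mkℚᵘ i 0)
  below : ∀ q → q ℚ.< i ℚ./ 1 → ↥ q ℤ.< i ℤ.* ↧ q
  below q@record{} q<i = subst (ℤ._< i ℤ.* ↧ q) (ℤ.*-identityʳ (↥ q))
    (ℚᵘ.drop-*<* (ℚᵘ.<-respʳ-≃ i/1≃i (ℚ.toℚᵘ-mono-< q<i)))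
  above : ∀ q → i ℚ./ 1 ℚ.< q → i ℤ.* ↧ q ℤ.< ↥ q
  above q@record{} i<q = subst (i ℤ.* ↧ q ℤ.<_) (ℤ.*-identityʳ (↥ q))
    (ℚᵘ.drop-*<* (ℚᵘ.<-respˡ-≃ i/1≃i (ℚ.toℚᵘ-mono-< i<q)))

-- Natural numbers inside the rationals and the reals

ℕ→ℚ-+ : ∀ m n → ℕ→ℚ (m + n) ≡ ℕ→ℚ m ℚ.+ ℕ→ℚ n
ℕ→ℚ-+ zero    n = sym (ℚ.+-identityˡ (ℕ→ℚ n))
ℕ→ℚ-+ (suc m) n = trans (ℕ→ℚ-suc (m + n)) (trans (cong (1ℚ ℚ.+_) (ℕ→ℚ-+ m n))
  (trans (sym (ℚ.+-assoc 1ℚ (ℕ→ℚ m) (ℕ→ℚ n))) (cong (ℚ._+ ℕ→ℚ n) (sym (ℕ→ℚ-suc m)))))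

ℕ→ℚ-* : ∀ m n → ℕ→ℚ (m * n) ≡ ℕ→ℚ m ℚ.* ℕ→ℚ n
ℕ→ℚ-* zero    n = sym (ℚ.*-zeroˡ (ℕ→ℚ n))
ℕ→ℚ-* (suc m) n = trans (ℕ→ℚ-+ n (m * n)) (trans (cong (ℕ→ℚ n ℚ.+_) (ℕ→ℚ-* m n))
  (trans (solve 2 (λ m n → n :+ m :* n := (con 1ℚ :+ m) :* n) refl (ℕ→ℚ m) (ℕ→ℚ n))
         (cong (ℚ._* ℕ→ℚ n) (sym (ℕ→ℚ-suc m)))))

ℕ→ℚ-2^ : ∀ n → ℕ→ℚ (2 ^ n) ≡ 2ℚ ^ℚ n
ℕ→ℚ-2^ zero    = refl
ℕ→ℚ-2^ (suc n) = trans (ℕ→ℚ-* 2 (2 ^ n)) (cong (2ℚ ℚ.*_) (ℕ→ℚ-2^ n))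

ℕ→ℚ-mono-≤ : ∀ {m n} → m ≤ n → ℕ→ℚ m ℚ.≤ ℕ→ℚ n
ℕ→ℚ-mono-≤ {n = n} z≤n = 0≤ℕ→ℚ n
ℕ→ℚ-mono-≤ {suc m} {suc n} (s≤s m≤n) = subst₂ ℚ._≤_ (sym (ℕ→ℚ-suc m)) (sym (ℕ→ℚ-suc n))
  (ℚ.+-monoʳ-≤ 1ℚ (ℕ→ℚ-mono-≤ m≤n))

0<ℕ→ℚ : ∀ n .⦃ _ : NonZero n ⦄ → 0ℚ ℚ.< ℕ→ℚ n
0<ℕ→ℚ (suc n) = subst (0ℚ ℚ.<_) (sym (ℕ→ℚ-suc n)) (+-pos 0<1 (0≤ℕ→ℚ n))

2^-ℕ→ℝ : ∀ n → 2^ ℕ→ℝ n ≃ℝ ℕ→ℝ (2 ^ n)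
2^-ℕ→ℝ n = ≃ℝ-trans {2^ ℕ→ℝ n} {2^ log₂ (2ℚ ^ℚ n)} {ℕ→ℝ (2 ^ n)}
  (2^-cong {ℕ→ℝ n} {log₂ (2ℚ ^ℚ n)} (ℤ≃log₂-pow2 (+ n)))
  (≃ℝ-trans {2^ log₂ (2ℚ ^ℚ n)} {ℚ→ℝ (2ℚ ^ℚ n)} {ℕ→ℝ (2 ^ n)}
    (2^-log₂ (2ℚ ^ℚ n)) (≃ℝ-reflexive (cong ℚ→ℝ (sym (ℕ→ℚ-2^ n)))))
  where
  instance
    2^n-pos : Positive (2ℚ ^ℚ n)
    2^n-pos = positive (0<pow2 (+ n))

-- The error term and the exponent

4ℚ : ℚ
4ℚ = ℕ→ℚ 4

module _ (n : ℕ) .⦃ _ : NonZero n ⦄ where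
  private
    inv : ∃ λ y → 0ℚ ℚ.< y × ℕ→ℚ n ℚ.* y ≡ 1ℚ
    inv = inverse (0<ℕ→ℚ n)
    y    = proj₁ inv
    0<y  = proj₁ (proj₂ inv)
    ny≡1 = proj₂ (proj₂ inv)
    0<4 : 0ℚ ℚ.< 4ℚ
    0<4 = ℚ.positive⁻¹ 4ℚ

  -- This is (n + 4) / n, split as 1 + 4 / n to show that it exceeds 1 and tends to 1.
  ratio : ℚ
  ratio = 1ℚ ℚ.+ 4ℚ ℚ.* y

  1<ratio : 1ℚ ℚ.< ratio
  1<ratio = <-by {1ℚ} {ratio} (4ℚ ℚ.* y) (*-pos {4ℚ} {y} 0<4 0<y) refl

  ratio-pos : Positive ratio
  ratio-pos = positive (ℚ.<-trans 0<1 1<ratio)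

  ratio*n : ratio ℚ.* ℕ→ℚ n ≡ ℕ→ℚ (n + 4)
  ratio*n = trans (solve 3 (λ f y k → (con 1ℚ :+ f :* y) :* k := k :+ f :* (k :* y)) refl 4ℚ y (ℕ→ℚ n))
           (trans (cong (λ z → ℕ→ℚ n ℚ.+ 4ℚ ℚ.* z) ny≡1)
           (trans (cong (ℕ→ℚ n ℚ.+_) (ℚ.*-identityʳ 4ℚ)) (sym (ℕ→ℚ-+ n 4))))

  -- Division by n gives 4 / n < z - 1; the hypothesis is kept in product form to match
  -- `archimedean`.
  ratio< : ∀ {z} → 4ℚ ℚ.< ℕ→ℚ n ℚ.* (z ℚ.- 1ℚ) → ratio ℚ.< z
  ratio< {z} h = subst (ratio ℚ.<_)
    (trans (cong (1ℚ ℚ.+_) cancel) (solve 1 (λ z → con 1ℚ :+ (z :- con 1ℚ) := z) refl z))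
    (ℚ.+-monoʳ-< 1ℚ (*ʳ-mono-< {4ℚ} {ℕ→ℚ n ℚ.* (z ℚ.- 1ℚ)} {y} 0<y h))
    where
    cancel : ℕ→ℚ n ℚ.* (z ℚ.- 1ℚ) ℚ.* y ≡ z ℚ.- 1ℚ
    cancel = trans (solve 3 (λ k w y → k :* w :* y := w :* (k :* y)) refl (ℕ→ℚ n) (z ℚ.- 1ℚ) y)
            (trans (cong ((z ℚ.- 1ℚ) ℚ.*_) ny≡1) (ℚ.*-identityʳ (z ℚ.- 1ℚ)))

-- ε n = log₂ ((n + 4) / n); the value at 0 is irrelevant.
ε : ℕ → ℝ
ε zero      = ℕ→ℝ 0
ε n@(suc _) = log₂ (ratio n) ⦃ ratio-pos n ⦄

1^n≡1 : ∀ n → 1ℚ ^ℚ n ≡ 1ℚ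
1^n≡1 zero    = refl
1^n≡1 (suc n) = trans (ℚ.*-identityˡ (1ℚ ^ℚ n)) (1^n≡1 n)

-- For δ = a / b with a > 0, choose z > 1 with z ^ b < 2 ^ a. Once n (z - 1) > 4, the ratio is below
-- z and its logarithm below δ. The logarithm is positive, hence above -δ.
ε-tendsToZero : TendsToZero ε
ε-tendsToZero δ 0<δ = suc k , close
  where
  0<↥δ : + 0 ℤ.< ↥ δ
  0<↥δ = subst (+ 0 ℤ.<_) (ℤ.*-identityʳ (↥ δ)) (ℚ.drop-*<* 0<δ)
  opening = ^-open-above {1ℚ} {pow2 (↥ δ)} (ℚ.<⇒≤ 0<1) (↧ₙ δ)
    (subst (ℚ._< pow2 (↥ δ)) (sym (1^n≡1 (↧ₙ δ))) (pow2-mono-< 0<↥δ))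
  z    = proj₁ opening
  1<z  = proj₁ (proj₂ opening)
  zᵇ<  = proj₂ (proj₂ opening)
  arch = archimedean 4ℚ {z ℚ.- 1ℚ} (x<y⇒0<y-x 1<z)
  k    = proj₁ arch

  close : ∀ n → suc k ≤ n → L (ε n) (ℚ.- δ) × U (ε n) δ
  close n@(suc _) k≤ = >2^-lower {ratio n} {ℚ.- δ} {0ℚ} (ℚ.neg-antimono-≤ (ℚ.<⇒≤ 0<δ)) >2^0 , <2^δ
    where
    0⊔ratio : 0ℚ ℚ.⊔ ratio n ≡ ratio n
    0⊔ratio = 0⊔-pos (ℚ.<-trans 0<1 (1<ratio n))
    >2^0 : ratio n >2^ 0ℚ
    >2^0 = subst (1ℚ ℚ.<_) (sym (trans (ℚ.*-identityʳ (0ℚ ℚ.⊔ ratio n)) 0⊔ratio)) (1<ratio n)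
    ratio<z : ratio n ℚ.< z
    ratio<z = ratio< n (ℚ.<-≤-trans (proj₂ arch)
      (ℚ.*-monoʳ-≤-nonNeg (z ℚ.- 1ℚ) ⦃ ℚ.nonNegative (ℚ.<⇒≤ (x<y⇒0<y-x 1<z)) ⦄ (ℕ→ℚ-mono-≤ k≤)))
    <2^δ : ratio n <2^ δ
    <2^δ = subst (λ x → x ^ℚ ↧ₙ δ ℚ.< pow2 (↥ δ)) (sym 0⊔ratio)
      (ℚ.≤-<-trans (^-mono-≤ (ℚ.<⇒≤ (ℚ.<-trans 0<1 (1<ratio n))) (ℚ.<⇒≤ ratio<z) (↧ₙ δ)) zᵇ<)

-- Each summand is the logarithm of a factor: 2ⁿ, n, ½ and (n + 4) / n.
exponent : ∀ n .⦃ _ : NonZero n ⦄ →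
  2^ (ℕ→ℝ n +ℝ log₂ℕ n -ℝ ℕ→ℝ 1 +ℝ ε n) ≃ℝ ℕ→ℝ ((n + 4) * 2 ^ (n ∸ 1))
exponent n@(suc m) = ≃ℝ-trans {2^ s} {2^ log₂ P₄} {ℕ→ℝ K} (2^-cong {s} {log₂ P₄} sum)
  (≃ℝ-trans {2^ log₂ P₄} {ℚ→ℝ P₄} {ℕ→ℝ K} (2^-log₂ P₄) (≃ℝ-reflexive (cong ℚ→ℝ P₄≡K)))
  where
  K = (n + 4) * 2 ^ m
  s₂ = ℕ→ℝ n +ℝ log₂ℕ n
  s₃ = s₂ -ℝ ℕ→ℝ 1
  s  = s₃ +ℝ ε n
  -- Partial products of these factors; n cancels against the ratio and ½ against one factor of 2ⁿ,
  -- which leaves `K`.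
  P₁ P₂ P₃ P₄ : ℚ
  P₁ = 2ℚ ^ℚ n
  P₂ = P₁ ℚ.* ℕ→ℚ n
  P₃ = P₂ ℚ.* ½
  P₄ = P₃ ℚ.* ratio n
  0<P₁ = 0<pow2 (+ n)
  0<P₂ = *-pos {P₁} {ℕ→ℚ n} 0<P₁ (0<ℕ→ℚ n)
  0<P₃ = *-pos {P₂} {½} 0<P₂ (ℚ.positive⁻¹ ½)
  instance
    pos-n : Positive (ℕ→ℚ n)
    pos-n = positive (0<ℕ→ℚ n)
    pos-r : Positive (ratio n)
    pos-r = ratio-pos n
    pos₁ : Positive P₁
    pos₁ = positive 0<P₁
    pos₂ : Positive P₂
    pos₂ = positive 0<P₂
    pos₃ : Positive P₃
    pos₃ = positive 0<P₃
    pos₄ : Positive P₄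
    pos₄ = positive (*-pos {P₃} {ratio n} 0<P₃ (ℚ.positive⁻¹ (ratio n)))

  extend : ∀ {x y} p q .⦃ _ : Positive p ⦄ .⦃ _ : Positive q ⦄ .⦃ _ : Positive (p ℚ.* q) ⦄ →
           x ≃ℝ log₂ p → y ≃ℝ log₂ q → x +ℝ y ≃ℝ log₂ (p ℚ.* q)
  extend {x} {y} p q e f = ≃ℝ-trans {x +ℝ y} {log₂ p +ℝ log₂ q} {log₂ (p ℚ.* q)}
    (+ℝ-cong {x} {log₂ p} {y} {log₂ q} e f) (log₂-* p q)

  sum₂ : s₂ ≃ℝ log₂ P₂
  sum₂ = extend {ℕ→ℝ n} {log₂ℕ n} P₁ (ℕ→ℚ n) (ℤ≃log₂-pow2 (+ n)) (≃ℝ-reflexive {log₂ℕ n} refl)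
  minus-one : -ℝ ℕ→ℝ 1 ≃ℝ log₂ ½
  minus-one = ≃ℝ-trans { -ℝ ℕ→ℝ 1} {ℚ→ℝ (-[1+ 0 ] ℚ./ 1)} {log₂ ½}
    (-ℝ-ℚ→ℝ 1ℚ) (ℤ≃log₂-pow2 -[1+ 0 ])
  sum₃ : s₃ ≃ℝ log₂ P₃
  sum₃ = extend {s₂} { -ℝ ℕ→ℝ 1} P₂ ½ sum₂ minus-one
  sum : s ≃ℝ log₂ P₄
  sum = extend {s₃} {ε n} P₃ (ratio n) sum₃ (≃ℝ-reflexive {ε n} refl)

  P₄≡K : P₄ ≡ ℕ→ℚ K
  P₄≡K = trans
    (solve 3 (λ t k r → con 2ℚ :* t :* k :* con ½ :* r := r :* k :* t) refl (2ℚ ^ℚ m) (ℕ→ℚ n) (ratio n))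
    (trans (cong₂ ℚ._*_ (ratio*n n) (sym (ℕ→ℚ-2^ m))) (sym (ℕ→ℚ-* (n + 4) (2 ^ m))))

mainTheorem5 : Σ[ c ∈ ℕ ]
    (∀ (n : ℕ) .⦃ _ : NonZero n ⦄ → Q n ≤ 2 ^ ((n + c) * 2 ^ (n ∸ 1)))
    ×
    (Σ[ ε ∈ (ℕ → ℝ) ]
    TendsToZero ε
    ×
    (∀ (n : ℕ) .⦃ _ : NonZero n ⦄ →
    ℕ→ℝ (2 ^ ((n + c) * 2 ^ (n ∸ 1)))
    ≃ℝ 2^ (2^ (ℕ→ℝ n +ℝ log₂ℕ n -ℝ ℕ→ℝ 1 +ℝ ε n))))
mainTheorem5 = 4 , (λ { (suc n) → Q-bound-suc n }) , ε , ε-tendsToZero , asymptotics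
  where
  asymptotics : ∀ n .⦃ _ : NonZero n ⦄ →
    ℕ→ℝ (2 ^ ((n + 4) * 2 ^ (n ∸ 1))) ≃ℝ 2^ (2^ (ℕ→ℝ n +ℝ log₂ℕ n -ℝ ℕ→ℝ 1 +ℝ ε n))
  asymptotics n = ≃ℝ-sym {2^ 2^ s} {ℕ→ℝ (2 ^ K)}
    (≃ℝ-trans {2^ 2^ s} {2^ ℕ→ℝ K} {ℕ→ℝ (2 ^ K)} (2^-cong {2^ s} {ℕ→ℝ K} (exponent n)) (2^-ℕ→ℝ K))
    where
    K = (n + 4) * 2 ^ (n ∸ 1)
    s = ℕ→ℝ n +ℝ log₂ℕ n -ℝ ℕ→ℝ 1 +ℝ ε n
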